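{- There exists a two-sided tolerant tester for clusterability in the dense signed graph model with query complexity $\widetilde{O}(1/\epsilon^7)$. That is, there is a randomized algorithm that, given $\epsilon\in(0,1)$ and query access to a signed graph $G$ on $N$ nodes in the dense signed graph model, makes $\widetilde{O}(1/\epsilon^7)$ queries, accepts with probability at least $2/3$ if $G$ is $\epsilon/4$-close to being clusterable, and rejects with probability at least $2/3$ if $G$ is $\epsilon$-far from being clusterable.
   Context: A signed graph is $G=(V,E,\sigma)$ with node set $V=[N]$, a simple undirected edge set $E$, and a sign $\sigma:E\to\{+,-\}$ on each edge. It is clusterable if there is a partition of the nodes into some (a priori unknown) number of components such that every positive edge connects two nodes in the same component and every negative edge connects two nodes in different components. Dense signed graph model: the algorithm knows $N$ and may query pairs $(v,w)\in[N]\times[N]$; the answer is $0$ if $v,w$ are not adjacent, and otherwise the sign $+$ or $-$ of the edge. A signed graph is $\epsilon$-far from a property $\mathcal P$ if at least $\epsilon N^2$ edge modifications (addition, removal or sign switch) have to be made to obtain a signed graph on $[N]$ satisfying $\mathcal P$; it is $\epsilon$-close to $\mathcal P$ if at most $\epsilon N^2$ edge modifications suffice. A tolerant tester for $\mathcal P$ with parameters $\epsilon_1<\epsilon_2$ must accept (with probability at least $2/3$) inputs that are $\epsilon_1$-close to $\mathcal P$ and reject (with probability at least $2/3$) inputs that are $\epsilon_2$-far from $\mathcal P$. Two-sided means that it may err with the allowed probability in both cases. $\widetilde{O}(\cdot)$ hides factors polylogarithmic in its argument and in $N$.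
   Formalization: The parameter ε ranges over the rational numbers in (0,1) instead of all real numbers in (0,1). -}

module Defs where

import Algebra.Definitions.RawSemiring
import Algebra.Properties.CommutativeMonoid.Sum
open import Data.Bool.Base using (Bool; true; false; if_then_else_; _∧_; not)
import Data.Bool.Properties as Bool
open import Data.Fin.Base using (Fin)
import Data.Fin.Properties as Fin
open import Data.Integer.Base using (+_; ∣_∣)
open import Data.Maybe.Base using (Maybe; just; nothing)
import Data.Maybe.Properties as Maybe
open import Data.Nat.Base as ℕ using (ℕ; suc; NonZero)
open import Data.Nat.Logarithm using (⌈log₂_⌉)
import Data.Nat.Properties as ℕ
open import Data.Product.Base using (∃₂; _×_)
open import Data.Rational.Base
  using (ℚ; 0ℚ; 1ℚ; _/_; 1/_; _*_; _≤_; _<_; ceiling; >-nonZero; +-*-rawSemiring)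
import Data.Rational.Properties as ℚ
open import Data.Sign.Base using (Sign)
import Data.Sign.Properties as Sign
open import Data.Vec.Functional using (foldr)
open import Relation.Binary.PropositionalEquality.Core using (_≡_; _≢_)
open import Relation.Nullary.Decidable.Core using (Dec; does)

open Algebra.Definitions.RawSemiring +-*-rawSemiring public using (_^_)

module Sumℕ = Algebra.Properties.CommutativeMonoid.Sum ℕ.+-0-commutativeMonoid
module Sumℚ = Algebra.Properties.CommutativeMonoid.Sum ℚ.+-0-commutativeMonoid

fromℕ : ℕ → ℚ
fromℕ n = + n / 1

-- `label v w` is the answer to the query (v , w): `nothing` if v and w are
-- not adjacent, and `just` the sign of the edge {v , w} otherwise.

record SignedGraph (N : ℕ) : Set where
  field
    label       : Fin N → Fin N → Maybe Sign
    symmetric   : ∀ v w → label v w ≡ label w v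
    irreflexive : ∀ v → label v v ≡ nothing

open SignedGraph public

-- A partition into k components is a colouring by Fin k.  Components may be
-- empty, which is harmless because k is existentially quantified.

Clusterable : ∀ {N} → SignedGraph N → Set
Clusterable {N} G = ∃₂ λ (k : ℕ) (component : Fin N → Fin k) →
  (∀ v w → label G v w ≡ just Sign.+ → component v ≡ component w) ×
  (∀ v w → label G v w ≡ just Sign.- → component v ≢ component w)

_≟ˡ_ : (a b : Maybe Sign) → Dec (a ≡ b)
_≟ˡ_ = Maybe.≡-dec Sign._≟_

-- Adding, removing or re-signing one undirected edge is one modification, so
-- each unordered pair {v , w} is counted once, as v < w.

modifications : ∀ {N} → SignedGraph N → SignedGraph N → ℕ
modifications G H = Sumℕ.sum λ v → Sumℕ.sum λ w →
  if does (v Fin.<? w) ∧ not (does (label G v w ≟ˡ label H v w)) then 1 else 0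

Property : ℕ → Set₁
Property N = SignedGraph N → Set

Close : ∀ {N} → ℚ → Property N → SignedGraph N → Set
Close {N} ε P G = ∃₂ λ H (_ : P H) →
  fromℕ (modifications G H) ≤ ε * fromℕ (N ℕ.* N)

Far : ∀ {N} → ℚ → Property N → SignedGraph N → Set
Far {N} ε P G = ∀ H → P H →
  ε * fromℕ (N ℕ.* N) ≤ fromℕ (modifications G H)

-- Adaptive randomized query algorithms on graphs with node set Fin N; `true`
-- means accept, and `random m` draws a fresh uniform element of Fin m.

data Algorithm (N : ℕ) : Set where
  halt   : Bool → Algorithm N
  query  : (v w : Fin N) → (Maybe Sign → Algorithm N) → Algorithm N
  random : (m : ℕ) .{{_ : NonZero m}} → (Fin m → Algorithm N) → Algorithm N

probability : ∀ {N} → Bool → SignedGraph N → Algorithm N → ℚ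
probability b G (halt b′)     = if does (b′ Bool.≟ b) then 1ℚ else 0ℚ
probability b G (query v w k) = probability b G (k (label G v w))
probability b G (random m k)  =
  (+ 1 / m) * Sumℚ.sum λ i → probability b G (k i)

-- The largest number of queries on input G over all random outcomes.

queries : ∀ {N} → SignedGraph N → Algorithm N → ℕ
queries G (halt _)      = 0
queries G (query v w k) = suc (queries G (k (label G v w)))
queries G (random m k)  = foldr ℕ._⊔_ 0 λ i → queries G (k i)

record IsTolerantTester {N : ℕ} (P : Property N) (ε₁ ε₂ : ℚ)
                        (A : Algorithm N) : Set where
  field
    accepts : ∀ G → Close ε₁ P G → + 2 / 3 ≤ probability true G A
    rejects : ∀ G → Far ε₂ P G → + 2 / 3 ≤ probability false G A

-- N must be positive: the graph on no nodes is both ε₁-close to and ε₂-far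
-- from being clusterable.

record Parameters : Set where
  field
    ε   : ℚ
    0<ε : 0ℚ < ε
    ε<1 : ε < 1ℚ
    N   : ℕ
    0<N : 0 ℕ.< N

  1/ε : ℚ
  1/ε = 1/_ ε {{>-nonZero 0<ε}}

open Parameters public

-- f is in Õ(g), the hidden factor being polylogarithmic in g and in N.  The
-- summand 1 keeps the factor at least 1 when both logarithms vanish.

infix 4 _∈Õ_

_∈Õ_ : (Parameters → ℕ) → (Parameters → ℚ) → Set
f ∈Õ g = ∃₂ λ (C c : ℕ) → ∀ p →
  fromℕ (f p) ≤
    fromℕ C * g p *
    fromℕ ((1 ℕ.+ ⌈log₂ ∣ ceiling (g p) ∣ ⌉ ℕ.+ ⌈log₂ N p ⌉) ℕ.^ c)

{-# OPTIONS --safe #-}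
module Submission where

-- Let the cost of a colouring be the fraction of ordered pairs of nodes that it
-- violates: it is at most ε/2 for some colouring if the graph is ε/4-close, and
-- at least 2ε for every colouring if the graph is ε-far.  With r about 100/ε, the
-- nodes are split into r intervals, and for each interval r² random nodes are
-- drawn.  A guess π of the colours of the drawn nodes extends to all nodes: every
-- node takes the colour that looks best against the sample of its interval.  The
-- tester accepts if some guess violates few of m further random pairs.
--
-- Close graphs: recolour a good clustering interval by interval, guessing the
-- current colours of each sample.  The squared errors of the estimated gains of
-- one node, summed over all colours, have expectation O(1/r²), whatever the number
-- of colours; together with the interaction inside an interval this costs at most
-- 6/r in expectation over the whole process, and Markov's inequality applies.
--
-- Far graphs: a fixed guess violates few pairs with probability exponentially
-- small in m, and there are only N^(r³) guesses, so m of order r · r³ log N is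
-- enough.  Each pair costs 2r³ + 1 queries, hence O(r⁷ log N) in total.

open import Defs
open import Algebra.Bundles using (CommutativeRing)
import Algebra.Properties.CommutativeSemiring.Exp
import Algebra.Properties.Semiring.Exp
import Algebra.Properties.Semiring.Sum
open import Data.Bool.Base using (Bool; true; false; if_then_else_; _∧_; not)
open import Data.Fin.Base using (Fin; zero; suc; toℕ)
import Data.Fin.Properties as Fin
import Data.Integer.Base as ℤ
import Data.Integer.Properties as ℤ
open import Data.List.Base using (allFin)
import Data.List.Extrema
open import Data.List.Membership.Propositional.Properties using (∈-allFin)
import Data.List.Relation.Unary.All as All
open import Data.Maybe.Base using (Maybe; just; nothing)
open import Data.Nat.Base as ℕ using (ℕ; zero; suc; NonZero)
open import Data.Nat.Coprimality using (Coprime)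
import Data.Nat.DivMod as ℕ
open import Data.Nat.Induction using (<-wellFounded)
open import Data.Nat.Logarithm using (⌈log₂_⌉; ⌈log₂⌉-mono-≤; ⌈log₂⌈n/2⌉⌉≡⌈log₂n⌉∸1)
import Data.Nat.Properties as ℕ
import Data.Nat.Solver
open import Data.Product.Base using (Σ; _×_; _,_; uncurry; ∃; proj₁; proj₂)
open import Data.Rational.Base
  using (ℚ; mkℚ; 0ℚ; 1ℚ; _/_; _+_; _*_; _-_; -_; _≤_; _<_; Positive; ceiling;
         nonNegative; positive; >-nonZero; toℚᵘ)
import Data.Rational.Properties as ℚ
open import Data.Rational.Solver using (module +-*-Solver)
import Data.Rational.Unnormalised.Base as ℚᵘ
import Data.Rational.Unnormalised.Properties as ℚᵘ
open import Data.Sign.Base using (Sign)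
open import Data.Sum.Base using (inj₁; inj₂)
open import Data.Vec.Base using (Vec; []; _∷_; map)
open import Data.Vec.Functional using (foldr)
open import Induction.WellFounded using (Acc; acc)
open import Relation.Binary.Bundles using (DecTotalOrder)
open import Relation.Binary.Definitions using (tri<; tri≈; tri>)
open import Relation.Binary.PropositionalEquality
open import Relation.Nullary.Decidable using (map′; dec-true; dec-false)
open import Relation.Nullary.Decidable.Core using (Dec; does; yes; no)
open import Relation.Nullary.Negation.Core using (¬_; contradiction)
open import Relation.Unary using (Decidable)

open +-*-Solver using (solve; _:=_; _:+_; _:*_; _:-_; :-_; con)

module SumRing = Algebra.Properties.Semiring.Sum (CommutativeRing.semiring ℚ.+-*-commutativeRing)
module Exp = Algebra.Properties.Semiring.Exp (CommutativeRing.semiring ℚ.+-*-commutativeRing)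
module CExp = Algebra.Properties.CommutativeSemiring.Exp (CommutativeRing.commutativeSemiring ℚ.+-*-commutativeRing)

private variable
  Ω Ω′ Ω″ : Set
  M n κ κ′ : ℕ
  p q z : ℚ

-- Order and arithmetic of the rationals, finite sums

0≤1 : 0ℚ ≤ 1ℚ
0≤1 = ℚ.nonNegative⁻¹ 1ℚ

0≤+ : 0ℚ ≤ p → 0ℚ ≤ q → 0ℚ ≤ p + q
0≤+ = ℚ.+-mono-≤

*-monoʳ : 0ℚ ≤ z → p ≤ q → z * p ≤ z * q
*-monoʳ {z} 0≤z = ℚ.*-monoˡ-≤-nonNeg z {{nonNegative 0≤z}}

*-monoˡ : 0ℚ ≤ z → p ≤ q → p * z ≤ q * z
*-monoˡ {z} 0≤z = ℚ.*-monoʳ-≤-nonNeg z {{nonNegative 0≤z}}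

0≤* : 0ℚ ≤ p → 0ℚ ≤ q → 0ℚ ≤ p * q
0≤* {p} {q} 0≤p 0≤q = subst (_≤ p * q) (ℚ.*-zeroʳ p) (*-monoʳ 0≤p 0≤q)

≤-+ : ∀ {d} → q ≡ p + d → 0ℚ ≤ d → p ≤ q
≤-+ {q} {p} {d} refl 0≤d =
  subst (_≤ p + d) (ℚ.+-identityʳ p) (ℚ.+-monoʳ-≤ p 0≤d)

≤⇒0≤- : p ≤ q → 0ℚ ≤ q - p
≤⇒0≤- {p} {q} p≤q = subst (_≤ q - p) (ℚ.+-inverseʳ p) (ℚ.+-monoˡ-≤ (- p) p≤q)

0<* : ∀ {p q} → 0ℚ < p → 0ℚ < q → 0ℚ < p * q
0<* {p} {q} 0<p 0<q = ℚ.positive⁻¹ (p * q) {{ℚ.pos*pos⇒pos p {{positive 0<p}} q {{positive 0<q}}}}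

cancelˡ : ∀ {p q r} → 0ℚ < r → r * p ≤ r * q → p ≤ q
cancelˡ {r = r} 0<r = ℚ.*-cancelˡ-≤-pos r {{positive 0<r}}

+-cancelˡ : ∀ r {p q} → r + p ≤ r + q → p ≤ q
+-cancelˡ r {p} {q} r+p≤r+q = subst₂ _≤_ (lemma p) (lemma q) (ℚ.+-monoʳ-≤ (- r) r+p≤r+q)
  where
  lemma : ∀ x → - r + (r + x) ≡ x
  lemma x = solve 2 (λ r x → :- r :+ (r :+ x) := x) refl r x

0≤p*p : ∀ p → 0ℚ ≤ p * p
0≤p*p p with ℚ.≤-total 0ℚ p
... | inj₁ 0≤p = 0≤* 0≤p 0≤p
... | inj₂ p≤0 = subst (0ℚ ≤_)
  (solve 1 (λ p → (:- p) :* (:- p) := p :* p) refl p)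
  (0≤* (ℚ.neg-antimono-≤ p≤0) (ℚ.neg-antimono-≤ p≤0))

-- `_/_` divides by a gcd, which does not reduce on a variable, so the laws of `fromℕ` are checked
-- on unnormalised representatives.
fromℕᵘ : ∀ n → toℚᵘ (fromℕ n) ℚᵘ.≃ ℚᵘ.mkℚᵘ (ℤ.+ n) 0
fromℕᵘ n = ℚ.toℚᵘ-fromℚᵘ (ℚᵘ.mkℚᵘ (ℤ.+ n) 0)

fromℕ-+ : ∀ m n → fromℕ (m ℕ.+ n) ≡ fromℕ m + fromℕ n
fromℕ-+ m n = ℚ.toℚᵘ-injective (begin
  toℚᵘ (fromℕ (m ℕ.+ n))                            ≈⟨ fromℕᵘ (m ℕ.+ n) ⟩
  ℚᵘ.mkℚᵘ (ℤ.+ (m ℕ.+ n)) 0                           ≈⟨ ℚᵘ.*≡* (cong (ℤ._* ℤ.+ 1) (sym (cong₂ ℤ._+_ (ℤ.*-identityʳ (ℤ.+ m)) (ℤ.*-identityʳ (ℤ.+ n))))) ⟩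
  ℚᵘ.mkℚᵘ (ℤ.+ m) 0 ℚᵘ.+ ℚᵘ.mkℚᵘ (ℤ.+ n) 0              ≈⟨ ℚᵘ.+-cong (fromℕᵘ m) (fromℕᵘ n) ⟨
  toℚᵘ (fromℕ m) ℚᵘ.+ toℚᵘ (fromℕ n)                ≈⟨ ℚ.toℚᵘ-homo-+ (fromℕ m) (fromℕ n) ⟨
  toℚᵘ (fromℕ m + fromℕ n)                          ∎)
  where open ℚᵘ.≃-Reasoning

fromℕ-suc : ∀ n → fromℕ (suc n) ≡ 1ℚ + fromℕ n
fromℕ-suc n = fromℕ-+ 1 n

fromℕ-* : ∀ m n → fromℕ (m ℕ.* n) ≡ fromℕ m * fromℕ n
fromℕ-* m n = ℚ.toℚᵘ-injective (begin
  toℚᵘ (fromℕ (m ℕ.* n))                            ≈⟨ fromℕᵘ (m ℕ.* n) ⟩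
  ℚᵘ.mkℚᵘ (ℤ.+ (m ℕ.* n)) 0                           ≈⟨ ℚᵘ.*≡* (cong (ℤ._* ℤ.+ 1) (ℤ.pos-* m n)) ⟩
  ℚᵘ.mkℚᵘ (ℤ.+ m) 0 ℚᵘ.* ℚᵘ.mkℚᵘ (ℤ.+ n) 0              ≈⟨ ℚᵘ.*-cong (fromℕᵘ m) (fromℕᵘ n) ⟨
  toℚᵘ (fromℕ m) ℚᵘ.* toℚᵘ (fromℕ n)                ≈⟨ ℚ.toℚᵘ-homo-* (fromℕ m) (fromℕ n) ⟨
  toℚᵘ (fromℕ m * fromℕ n)                          ∎)
  where open ℚᵘ.≃-Reasoning

fromℕ-mono : ∀ {m n} → m ℕ.≤ n → fromℕ m ≤ fromℕ n
fromℕ-mono {m} {n} m≤n = ℚ.toℚᵘ-cancel-≤ (begin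
  toℚᵘ (fromℕ m)   ≃⟨ fromℕᵘ m ⟩
  ℚᵘ.mkℚᵘ (ℤ.+ m) 0  ≤⟨ ℚᵘ.*≤* (ℤ.*-monoʳ-≤-nonNeg (ℤ.+ 1) (ℤ.+≤+ m≤n)) ⟩
  ℚᵘ.mkℚᵘ (ℤ.+ n) 0  ≃⟨ fromℕᵘ n ⟨
  toℚᵘ (fromℕ n)   ∎)
  where open ℚᵘ.≤-Reasoning

0≤fromℕ : ∀ n → 0ℚ ≤ fromℕ n
0≤fromℕ n = fromℕ-mono {0} {n} ℕ.z≤n

fromℕ-pos : ∀ n .{{_ : NonZero n}} → 0ℚ < fromℕ n
fromℕ-pos n = ℚ.positive⁻¹ (fromℕ n) {{ℚ.normalize-pos n 1}}

/-*-cancel : ∀ n .{{_ : NonZero n}} → (ℤ.+ 1 / n) * fromℕ n ≡ 1ℚ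
/-*-cancel n@(suc n-1) = ℚ.toℚᵘ-injective (begin
  toℚᵘ ((ℤ.+ 1 / n) * fromℕ n)                 ≈⟨ ℚ.toℚᵘ-homo-* (ℤ.+ 1 / n) (fromℕ n) ⟩
  toℚᵘ (ℤ.+ 1 / n) ℚᵘ.* toℚᵘ (fromℕ n)         ≈⟨ ℚᵘ.*-cong (ℚ.toℚᵘ-fromℚᵘ (ℚᵘ.mkℚᵘ (ℤ.+ 1) n-1)) (fromℕᵘ n) ⟩
  ℚᵘ.mkℚᵘ (ℤ.+ 1) n-1 ℚᵘ.* ℚᵘ.mkℚᵘ (ℤ.+ n) 0     ≈⟨ ℚᵘ.*≡* (ℤ.*-assoc (ℤ.+ 1) (ℤ.+ n) (ℤ.+ 1)) ⟩
  ℚᵘ.1ℚᵘ                                     ∎)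
  where open ℚᵘ.≃-Reasoning

0≤1/ : ∀ n .{{_ : NonZero n}} → 0ℚ ≤ ℤ.+ 1 / n
0≤1/ n = ℚ.nonNegative⁻¹ (ℤ.+ 1 / n) {{ℚ.normalize-nonNeg 1 n}}

sum-mono : ∀ {n} {f g : Fin n → ℚ} → (∀ i → f i ≤ g i) → Sumℚ.sum f ≤ Sumℚ.sum g
sum-mono {zero}  f≤g = ℚ.≤-refl
sum-mono {suc n} f≤g = ℚ.+-mono-≤ (f≤g zero) (sum-mono (λ i → f≤g (suc i)))

0≤sum : ∀ {n} {f : Fin n → ℚ} → (∀ i → 0ℚ ≤ f i) → 0ℚ ≤ Sumℚ.sum f
0≤sum {zero}  0≤f = ℚ.≤-refl
0≤sum {suc n} 0≤f = 0≤+ (0≤f zero) (0≤sum (λ i → 0≤f (suc i)))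

term≤sum : ∀ {n} {f : Fin n → ℚ} → (∀ i → 0ℚ ≤ f i) → ∀ i → f i ≤ Sumℚ.sum f
term≤sum {f = f} 0≤f zero    = ≤-+ refl (0≤sum (λ i → 0≤f (suc i)))
term≤sum {f = f} 0≤f (suc i) =
  ℚ.≤-trans (term≤sum (λ i → 0≤f (suc i)) i) (≤-+ (ℚ.+-comm (f zero) _) (0≤f zero))

sum-const : ∀ n c → Sumℚ.sum {n} (λ _ → c) ≡ fromℕ n * c
sum-const zero    c = sym (ℚ.*-zeroˡ c)
sum-const (suc n) c = begin
  c + Sumℚ.sum {n} (λ _ → c)      ≡⟨ cong (c +_) (sum-const n c) ⟩
  c + fromℕ n * c            ≡⟨ solve 2 (λ c m → c :+ m :* c := (con 1ℚ :+ m) :* c) refl c (fromℕ n) ⟩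
  (1ℚ + fromℕ n) * c         ≡⟨ cong (_* c) (fromℕ-suc n) ⟨
  fromℕ (suc n) * c          ∎
  where open ≡-Reasoning

fromℕ-sum : ∀ {n} (f : Fin n → ℕ) → fromℕ (Sumℕ.sum f) ≡ Sumℚ.sum (λ i → fromℕ (f i))
fromℕ-sum {zero}  f = refl
fromℕ-sum {suc n} f =
  trans (fromℕ-+ (f zero) (Sumℕ.sum (λ i → f (suc i))))
        (cong (fromℕ (f zero) +_) (fromℕ-sum (λ i → f (suc i))))

-- Finite expectations

-- A probability distribution given by its expectation functional: positive, linear and of total
-- mass 1. Products and powers are then composites of functionals, and no enumeration of `Ω` is
-- involved.
record Mean (Ω : Set) : Set where
  field
    𝔼        : (Ω → ℚ) → ℚ
    𝔼-mono   : ∀ {f g} → (∀ x → f x ≤ g x) → 𝔼 f ≤ 𝔼 g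
    𝔼-+      : ∀ f g → 𝔼 (λ x → f x + g x) ≡ 𝔼 f + 𝔼 g
    𝔼-*ˡ     : ∀ c f → 𝔼 (λ x → c * f x) ≡ c * 𝔼 f
    𝔼-1      : 𝔼 (λ _ → 1ℚ) ≡ 1ℚ

  -- Antisymmetry of the order takes the place of function extensionality.
  𝔼-cong : ∀ {f g} → (∀ x → f x ≡ g x) → 𝔼 f ≡ 𝔼 g
  𝔼-cong f≡g = ℚ.≤-antisym (𝔼-mono (λ x → ℚ.≤-reflexive (f≡g x)))
                           (𝔼-mono (λ x → ℚ.≤-reflexive (sym (f≡g x))))

  𝔼-const : ∀ c → 𝔼 (λ _ → c) ≡ c
  𝔼-const c = begin
    𝔼 (λ _ → c)       ≡⟨ 𝔼-cong (λ _ → sym (ℚ.*-identityʳ c)) ⟩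
    𝔼 (λ _ → c * 1ℚ)  ≡⟨ 𝔼-*ˡ c (λ _ → 1ℚ) ⟩
    c * 𝔼 (λ _ → 1ℚ)  ≡⟨ cong (c *_) 𝔼-1 ⟩
    c * 1ℚ            ≡⟨ ℚ.*-identityʳ c ⟩
    c                 ∎
    where open ≡-Reasoning

  𝔼-*ʳ : ∀ c f → 𝔼 (λ x → f x * c) ≡ 𝔼 f * c
  𝔼-*ʳ c f = trans (𝔼-cong (λ x → ℚ.*-comm (f x) c))
                   (trans (𝔼-*ˡ c f) (ℚ.*-comm c (𝔼 f)))

  𝔼-- : ∀ f g → 𝔼 (λ x → f x - g x) ≡ 𝔼 f - 𝔼 g
  𝔼-- f g = begin
    𝔼 (λ x → f x - g x)             ≡⟨ 𝔼-cong (λ x → solve 2 (λ a b → a :- b := a :+ con (- 1ℚ) :* b) refl (f x) (g x)) ⟩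
    𝔼 (λ x → f x + (- 1ℚ) * g x)    ≡⟨ 𝔼-+ f _ ⟩
    𝔼 f + 𝔼 (λ x → (- 1ℚ) * g x)    ≡⟨ cong (𝔼 f +_) (𝔼-*ˡ (- 1ℚ) g) ⟩
    𝔼 f + (- 1ℚ) * 𝔼 g              ≡⟨ solve 2 (λ a b → a :- b := a :+ con (- 1ℚ) :* b) refl (𝔼 f) (𝔼 g) ⟨
    𝔼 f - 𝔼 g                       ∎
    where open ≡-Reasoning

  𝔼-*-complement : ∀ a f → 𝔼 (λ x → a * (1ℚ - f x)) ≡ a * (1ℚ - 𝔼 f)
  𝔼-*-complement a f =
    trans (𝔼-*ˡ a (λ x → 1ℚ - f x)) (cong (a *_) (trans (𝔼-- (λ _ → 1ℚ) f) (cong (_- 𝔼 f) 𝔼-1)))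

  0≤𝔼 : ∀ {f} → (∀ x → 0ℚ ≤ f x) → 0ℚ ≤ 𝔼 f
  0≤𝔼 {f} 0≤f = subst (_≤ 𝔼 f) (𝔼-const 0ℚ) (𝔼-mono 0≤f)

  𝔼-sum : ∀ {n} (f : Fin n → Ω → ℚ) →
          𝔼 (λ x → Sumℚ.sum (λ i → f i x)) ≡ Sumℚ.sum (λ i → 𝔼 (f i))
  𝔼-sum {zero}  f = 𝔼-const 0ℚ
  𝔼-sum {suc n} f = trans (𝔼-+ (f zero) _) (cong (𝔼 (f zero) +_) (𝔼-sum (λ i → f (suc i))))

open Mean

-- Opaque, since comparing nested averages by unfolding them is exponential.
opaque
  average : ∀ n .{{_ : NonZero n}} → (Fin n → ℚ) → ℚ
  average n f = (ℤ.+ 1 / n) * Sumℚ.sum f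

  average≡ : ∀ n .{{_ : NonZero n}} f → average n f ≡ (ℤ.+ 1 / n) * Sumℚ.sum f
  average≡ n f = refl

  average-mono : ∀ n .{{_ : NonZero n}} {f g} → (∀ i → f i ≤ g i) → average n f ≤ average n g
  average-mono n f≤g = *-monoʳ (0≤1/ n) (sum-mono f≤g)

  average-+ : ∀ n .{{_ : NonZero n}} f g → average n (λ i → f i + g i) ≡ average n f + average n g
  average-+ n f g = trans (cong ((ℤ.+ 1 / n) *_) (Sumℚ.∑-distrib-+ f g))
                          (ℚ.*-distribˡ-+ (ℤ.+ 1 / n) (Sumℚ.sum f) (Sumℚ.sum g))

  average-*ˡ : ∀ n .{{_ : NonZero n}} c f → average n (λ i → c * f i) ≡ c * average n f
  average-*ˡ n c f = trans (cong ((ℤ.+ 1 / n) *_) (sym (SumRing.*-distribˡ-sum c f)))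
    (solve 3 (λ u c s → u :* (c :* s) := c :* (u :* s)) refl (ℤ.+ 1 / n) c (Sumℚ.sum f))

  average-1 : ∀ n .{{_ : NonZero n}} → average n (λ _ → 1ℚ) ≡ 1ℚ
  average-1 n = trans (cong ((ℤ.+ 1 / n) *_) (trans (sum-const n 1ℚ) (ℚ.*-identityʳ (fromℕ n)))) (/-*-cancel n)

uniform : ∀ n .{{_ : NonZero n}} → Mean (Fin n)
uniform n = record
  { 𝔼      = average n
  ; 𝔼-mono = average-mono n
  ; 𝔼-+    = average-+ n
  ; 𝔼-*ˡ   = average-*ˡ n
  ; 𝔼-1    = average-1 n
  }

dirac : Ω → Mean Ω
dirac a = record
  { 𝔼      = λ f → f a
  ; 𝔼-mono = λ f≤g → f≤g a
  ; 𝔼-+    = λ f g → refl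
  ; 𝔼-*ˡ   = λ c f → refl
  ; 𝔼-1    = refl
  }

image : (Ω → Ω′) → Mean Ω → Mean Ω′
image h μ = record
  { 𝔼      = λ f → 𝔼 μ (λ x → f (h x))
  ; 𝔼-mono = λ f≤g → 𝔼-mono μ (λ x → f≤g (h x))
  ; 𝔼-+    = λ f g → 𝔼-+ μ _ _
  ; 𝔼-*ˡ   = λ c f → 𝔼-*ˡ μ c _
  ; 𝔼-1    = 𝔼-1 μ
  }

infixr 4 _⊗_
_⊗_ : Mean Ω → Mean Ω′ → Mean (Ω × Ω′)
μ ⊗ ν = record
  { 𝔼      = λ f → 𝔼 μ (λ x → 𝔼 ν (λ y → f (x , y)))
  ; 𝔼-mono = λ f≤g → 𝔼-mono μ (λ x → 𝔼-mono ν (λ y → f≤g (x , y)))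
  ; 𝔼-+    = λ f g → trans (𝔼-cong μ (λ x → 𝔼-+ ν _ _)) (𝔼-+ μ _ _)
  ; 𝔼-*ˡ   = λ c f → trans (𝔼-cong μ (λ x → 𝔼-*ˡ ν c _)) (𝔼-*ˡ μ c _)
  ; 𝔼-1    = trans (𝔼-cong μ (λ _ → 𝔼-1 ν)) (𝔼-1 μ)
  }

iid : Mean Ω → ∀ n → Mean (Vec Ω n)
iid μ zero    = dirac []
iid μ (suc n) = image (uncurry _∷_) (μ ⊗ iid μ n)

-- A uniform mean is a scaled finite sum, and `μ` commutes with those by linearity.
𝔼-swap : ∀ (μ : Mean Ω) n .{{_ : NonZero n}} (f : Ω → Fin n → ℚ) →
         𝔼 μ (λ x → 𝔼 (uniform n) (f x)) ≡ 𝔼 (uniform n) (λ i → 𝔼 μ (λ x → f x i))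
𝔼-swap μ n f = begin
  𝔼 μ (λ x → average n (f x))                             ≡⟨ 𝔼-cong μ (λ x → average≡ n (f x)) ⟩
  𝔼 μ (λ x → (ℤ.+ 1 / n) * Sumℚ.sum (f x))                ≡⟨ 𝔼-*ˡ μ (ℤ.+ 1 / n) (λ x → Sumℚ.sum (f x)) ⟩
  (ℤ.+ 1 / n) * 𝔼 μ (λ x → Sumℚ.sum (f x))                ≡⟨ cong ((ℤ.+ 1 / n) *_) (𝔼-sum μ (λ i x → f x i)) ⟩
  (ℤ.+ 1 / n) * Sumℚ.sum (λ i → 𝔼 μ (λ x → f x i))        ≡⟨ average≡ n (λ i → 𝔼 μ (λ x → f x i)) ⟨
  average n (λ i → 𝔼 μ (λ x → f x i))                     ∎
  where open ≡-Reasoning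

average-* : ∀ n .{{_ : NonZero n}} f → fromℕ n * average n f ≡ Sumℚ.sum f
average-* n f = begin
  fromℕ n * average n f                        ≡⟨ cong (fromℕ n *_) (average≡ n f) ⟩
  fromℕ n * ((ℤ.+ 1 / n) * Sumℚ.sum f)         ≡⟨ solve 3 (λ u k s → k :* (u :* s) := u :* k :* s) refl (ℤ.+ 1 / n) (fromℕ n) (Sumℚ.sum f) ⟩
  (ℤ.+ 1 / n) * fromℕ n * Sumℚ.sum f           ≡⟨ cong (_* Sumℚ.sum f) (/-*-cancel n) ⟩
  1ℚ * Sumℚ.sum f                              ≡⟨ ℚ.*-identityˡ (Sumℚ.sum f) ⟩
  Sumℚ.sum f                                   ∎
  where open ≡-Reasoning

-- Query algorithms

-- A random draw in continuation-passing form together with its law. Drawing costs no queries, so a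
-- bound valid for all outcomes passes to the whole algorithm.
record Sampler (N : ℕ) (Ω : Set) : Set₁ where
  field
    mean : Mean Ω
    draw : (Ω → Algorithm N) → Algorithm N
    probability-draw : ∀ b G k → probability b G (draw k) ≡ 𝔼 mean (λ x → probability b G (k x))
    queries-draw : ∀ G k q → (∀ x → queries G (k x) ℕ.≤ q) → queries G (draw k) ℕ.≤ q

open Sampler

⊔-bounded : ∀ {n q} (f : Fin n → ℕ) → (∀ i → f i ℕ.≤ q) → foldr ℕ._⊔_ 0 f ℕ.≤ q
⊔-bounded {zero}  f f≤q = ℕ.z≤n
⊔-bounded {suc n} f f≤q = ℕ.⊔-lub (f≤q zero) (⊔-bounded (λ i → f (suc i)) (λ i → f≤q (suc i)))

drawUniform : ∀ {N} m .{{_ : NonZero m}} → Sampler N (Fin m)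
drawUniform m = record
  { mean = uniform m
  ; draw = random m
  ; probability-draw = λ b G k → sym (average≡ m (λ i → probability b G (k i)))
  ; queries-draw = λ G k q k≤q → ⊔-bounded (λ i → queries G (k i)) k≤q
  }

drawPair : ∀ {N} → Sampler N Ω → Sampler N Ω′ → Sampler N (Ω × Ω′)
drawPair S T = record
  { mean = mean S ⊗ mean T
  ; draw = λ k → draw S (λ x → draw T (λ y → k (x , y)))
  ; probability-draw = λ b G k → trans (probability-draw S b G _)
      (𝔼-cong (mean S) (λ x → probability-draw T b G _))
  ; queries-draw = λ G k q k≤q →
      queries-draw S G _ q (λ x → queries-draw T G _ q (λ y → k≤q (x , y)))
  }

drawIid : ∀ {N} → Sampler N Ω → ∀ n → Sampler N (Vec Ω n)
drawIid {Ω = Ω} {N = N} S n = record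
  { mean = iid (mean S) n
  ; draw = go n
  ; probability-draw = law n
  ; queries-draw = bound n
  }
  where
  go : ∀ n → (Vec Ω n → Algorithm N) → Algorithm N
  go zero    k = k []
  go (suc n) k = draw S (λ x → go n (λ xs → k (x ∷ xs)))

  law : ∀ n b G k → probability b G (go n k) ≡ 𝔼 (iid (mean S) n) (λ xs → probability b G (k xs))
  law zero    b G k = refl
  law (suc n) b G k = trans (probability-draw S b G _) (𝔼-cong (mean S) (λ x → law n b G _))

  bound : ∀ n G k q → (∀ xs → queries G (k xs) ℕ.≤ q) → queries G (go n k) ℕ.≤ q
  bound zero    G k q k≤q = k≤q []
  bound (suc n) G k q k≤q = queries-draw S G _ q (λ x → bound n G _ q (λ xs → k≤q (x ∷ xs)))

-- A deterministic query routine of exact cost `c`. For the analysis, running it amounts to handing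
-- `value G` to the continuation.
record Inspection (M c : ℕ) (Ω : Set) : Set where
  field
    run   : (Ω → Algorithm M) → Algorithm M
    value : SignedGraph M → Ω
    probability-run : ∀ b G k → probability b G (run k) ≡ probability b G (k (value G))
    queries-run : ∀ G k → queries G (run k) ≡ c ℕ.+ queries G (k (value G))

open Inspection

inspectEdge : Fin M → Fin M → Inspection M 1 (Maybe Sign)
inspectEdge v w = record
  { run = query v w
  ; value = λ G → label G v w
  ; probability-run = λ b G k → refl
  ; queries-run = λ G k → refl
  }

inspectWith : (Ω → Ω′ → Ω″) → Inspection M κ Ω → Inspection M κ′ Ω′ → Inspection M (κ ℕ.+ κ′) Ω″
inspectWith {κ = κ} {κ′ = κ′} f I J = record
  { run = λ k → run I (λ x → run J (λ y → k (f x y)))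
  ; value = λ G → f (value I G) (value J G)
  ; probability-run = λ b G k → trans (probability-run I b G _) (probability-run J b G _)
  ; queries-run = λ G k → trans (queries-run I G _)
      (trans (cong (κ ℕ.+_) (queries-run J G _)) (sym (ℕ.+-assoc κ κ′ _)))
  }

inspectAll : (Ω → Inspection M κ Ω′) → (xs : Vec Ω n) → Inspection M (n ℕ.* κ) (Vec Ω′ n)
inspectAll {κ = κ} I xs = record
  { run = go xs
  ; value = λ G → map (λ x → value (I x) G) xs
  ; probability-run = λ b G k → law xs b G k
  ; queries-run = λ G k → cost xs G k
  }
  where
  go : ∀ {n} → Vec _ n → (Vec _ n → Algorithm _) → Algorithm _
  go []       k = k []
  go (x ∷ xs) k = run (I x) (λ y → go xs (λ ys → k (y ∷ ys)))

  law : ∀ {n} (xs : Vec _ n) b G k →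
        probability b G (go xs k) ≡ probability b G (k (map (λ x → value (I x) G) xs))
  law []       b G k = refl
  law (x ∷ xs) b G k = trans (probability-run (I x) b G _) (law xs b G _)

  cost : ∀ {n} (xs : Vec _ n) G k →
         queries G (go xs k) ≡ n ℕ.* κ ℕ.+ queries G (k (map (λ x → value (I x) G) xs))
  cost []           G k = refl
  cost {suc n} (x ∷ xs) G k = trans (queries-run (I x) G _)
    (trans (cong (κ ℕ.+_) (cost xs G _)) (sym (ℕ.+-assoc κ (n ℕ.* κ) _)))

-- The verdict asks whether some guess is good; an exhaustive search settles this without queries.
Searchable : Set → Set₁
Searchable Ω = ∀ {P : Ω → Set} → Decidable P → Dec (∃ P)

any-Vec? : Searchable Ω → ∀ n → Searchable (Vec Ω n)
any-Vec? any? zero    P? = map′ (λ p → [] , p) (λ { ([] , p) → p }) (P? [])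
any-Vec? any? (suc n) P? =
  map′ (λ (x , xs , p) → x ∷ xs , p) (λ { (x ∷ xs , p) → x , xs , p })
       (any? (λ x → any-Vec? any? n (λ xs → P? (x ∷ xs))))

module Max = Data.List.Extrema (DecTotalOrder.totalOrder ℚ.≤-decTotalOrder)

-- The starting value `v` witnesses that there is a colour to choose.
argmax : Fin n → (Fin n → ℚ) → Fin n
argmax v f = Max.argmax f v (allFin _)

argmax-max : ∀ (v : Fin n) (f : Fin n → ℚ) a → f a ≤ f (argmax v f)
argmax-max v f a = All.lookup (Max.f[xs]≤f[argmax] {f = f} v (allFin _)) (∈-allFin a)

-- Conflicts, scores and the tester

𝟙 : Bool → ℚ
𝟙 b = if b then 1ℚ else 0ℚ

eq : Fin n → Fin n → ℚ
eq a b = 𝟙 (does (a Fin.≟ b))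

signℚ : Maybe Sign → ℚ
signℚ nothing       = 0ℚ
signℚ (just Sign.+) = 1ℚ
signℚ (just Sign.-) = - 1ℚ

-- Valued in ℕ because it is used both as a summand of counts and as an exponent.
conflict : Maybe Sign → Fin n → Fin n → ℕ
conflict nothing       a b = 0
conflict (just Sign.+) a b = if does (a Fin.≟ b) then 0 else 1
conflict (just Sign.-) a b = if does (a Fin.≟ b) then 1 else 0

-- Every unordered pair counts twice, so that ε-far graphs have cost at least 2ε.
cost : ∀ .{{_ : NonZero M}} → SignedGraph M → (Fin M → Fin M) → ℚ
cost {M} G c = 𝔼 (uniform M) λ v → 𝔼 (uniform M) λ w → fromℕ (conflict (label G v w) (c v) (c w))

-- Positive minus negative sample neighbours of colour `a`. Among the sampled neighbours this is, up
-- to sign and a constant independent of `a`, the number of violations that colour `a` causes.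
score : Vec (Maybe Sign) n → Vec (Fin M) n → Fin M → ℚ
score []       []       a = 0ℚ
score (l ∷ ls) (b ∷ bs) a = signℚ l * eq b a + score ls bs a

greedy : Fin M → Vec (Maybe Sign) n → Vec (Fin M) n → Fin M
greedy v ls bs = argmax v (score ls bs)

total : Vec (Ω → ℕ) n → Ω → ℕ
total []       x = 0
total (f ∷ fs) x = f x ℕ.+ total fs x

module Extension {N : ℕ} (part : Fin N → ℕ) (t : ℕ) where

  -- The i-th block of the sample serves the nodes v with part v = i.
  recolour : ∀ {l} → Fin N → ℕ → Vec (Vec (Maybe Sign) t) l → Vec (Vec (Fin N) t) l → Fin N → Fin N
  recolour v i []         []         a = a
  recolour v i (ls ∷ lss) (bs ∷ bss) a =
    recolour v (suc i) lss bss (if does (part v ℕ.≟ i) then greedy v ls bs else a)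

  profile : SignedGraph N → ∀ {l} → Vec (Vec (Fin N) t) l → Fin N → Vec (Vec (Maybe Sign) t) l
  profile G U v = map (map (label G v)) U

  extend : SignedGraph N → ∀ {l} → Vec (Vec (Fin N) t) l → Vec (Vec (Fin N) t) l → Fin N → Fin N
  -- The starting colour `v` is a placeholder, overwritten as soon as `part v` is the index of one
  -- of the blocks.
  extend G U π v = recolour v 0 (profile G U v) π v

module Tester (N : ℕ) .{{_ : NonZero N}} (part : Fin N → ℕ) (t r m threshold : ℕ) where
  open Extension part t

  -- Colours are named by nodes, `N` of them being enough for any partition; hence a guess has the
  -- same type as the sample that it colours.
  Sample Coloring : Set
  Sample   = Vec (Vec (Fin N) t) r
  Coloring = Vec (Vec (Fin N) t) r

  inspectProfile : Sample → (v : Fin N) → Inspection N (r ℕ.* (t ℕ.* 1)) (Vec (Vec (Maybe Sign) t) r)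
  inspectProfile U v = inspectAll (inspectAll (inspectEdge v)) U

  pairCost : ℕ
  pairCost = r ℕ.* (t ℕ.* 1) ℕ.+ r ℕ.* (t ℕ.* 1) ℕ.+ 1

  -- The value is a function of the guess, whereas the queries do not depend on it: one set of
  -- answers serves all guesses at once.
  inspectConflict : Sample → Fin N × Fin N → Inspection N pairCost (Coloring → ℕ)
  inspectConflict U (v , w) =
    inspectWith (λ (p , q) l π → conflict l (recolour v 0 p π v) (recolour w 0 q π w))
      (inspectWith _,_ (inspectProfile U v) (inspectProfile U w)) (inspectEdge v w)

  accepting? : (fs : Vec (Coloring → ℕ) m) → Dec (∃ λ π → total fs π ℕ.< threshold)
  accepting? fs = any-Vec? (any-Vec? Fin.any? t) r (λ π → total fs π ℕ.<? threshold)

  drawSample : Sampler N Sample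
  drawSample = drawIid (drawIid (drawUniform N) t) r

  drawPairs : Sampler N (Vec (Fin N × Fin N) m)
  drawPairs = drawIid (drawPair (drawUniform N) (drawUniform N)) m

  decide : Vec (Coloring → ℕ) m → Algorithm N
  decide fs = halt (does (accepting? fs))

  tester : Algorithm N
  tester = draw drawSample λ U → draw drawPairs λ ps →
    run (inspectAll (inspectConflict U) ps) decide

  observed : SignedGraph N → Sample → Vec (Fin N × Fin N) m → Vec (Coloring → ℕ) m
  observed G U ps = map (λ p → value (inspectConflict U p) G) ps

  probability-tester : ∀ b G → probability b G tester ≡
    𝔼 (mean drawSample) (λ U → 𝔼 (mean drawPairs) (λ ps →
      probability b G (decide (observed G U ps))))
  probability-tester b G = trans (probability-draw drawSample b G _)
    (𝔼-cong (mean drawSample) λ U →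
      trans (probability-draw drawPairs b G _)
        (𝔼-cong (mean drawPairs) λ ps →
          probability-run (inspectAll (inspectConflict U) ps) b G decide))

  queries-tester : ∀ G → queries G tester ℕ.≤ m ℕ.* pairCost
  queries-tester G = queries-draw drawSample G _ _ λ U →
    queries-draw drawPairs G _ _ λ ps →
      ℕ.≤-reflexive (trans (queries-run (inspectAll (inspectConflict U) ps) G decide)
                           (ℕ.+-identityʳ _))

-- Restated for the instance of _^_ in Defs: where the two instances meet, large
-- literal powers would be unfolded.

^-homo-* : ∀ x m n → x ^ (m ℕ.+ n) ≡ x ^ m * x ^ n
^-homo-* = Exp.^-homo-*

^-assocʳ : ∀ x m n → (x ^ m) ^ n ≡ x ^ (m ℕ.* n)
^-assocʳ = Exp.^-assocʳ

^-distrib-* : ∀ x y n → (x * y) ^ n ≡ x ^ n * y ^ n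
^-distrib-* = CExp.^-distrib-*

-- Inequalities for powers

0≤^ : 0ℚ ≤ p → ∀ n → 0ℚ ≤ p ^ n
0≤^ 0≤p zero    = 0≤1
0≤^ 0≤p (suc n) = 0≤* 0≤p (0≤^ 0≤p n)

^-monoˡ : 0ℚ ≤ p → p ≤ q → ∀ n → p ^ n ≤ q ^ n
^-monoˡ 0≤p p≤q zero    = ℚ.≤-refl
^-monoˡ 0≤p p≤q (suc n) = ℚ.≤-trans (*-monoʳ 0≤p (^-monoˡ 0≤p p≤q n))
                                    (*-monoˡ (0≤^ (ℚ.≤-trans 0≤p p≤q) n) p≤q)

^-antitone : 0ℚ ≤ p → p ≤ 1ℚ → ∀ {m n} → m ℕ.≤ n → p ^ n ≤ p ^ m
^-antitone 0≤p p≤1 {n = zero}  ℕ.z≤n = ℚ.≤-refl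
^-antitone {p} 0≤p p≤1 {n = suc n} ℕ.z≤n =
  ℚ.≤-trans (*-monoʳ 0≤p (^-antitone 0≤p p≤1 {n = n} ℕ.z≤n))
            (subst (_≤ 1ℚ) (sym (ℚ.*-identityʳ p)) p≤1)
^-antitone 0≤p p≤1 (ℕ.s≤s m≤n) = *-monoʳ 0≤p (^-antitone 0≤p p≤1 m≤n)

bernoulli : 0ℚ ≤ 1ℚ + p → ∀ n → 1ℚ + fromℕ n * p ≤ (1ℚ + p) ^ n
bernoulli {y} 0≤1+y zero = ℚ.≤-reflexive (solve 1 (λ y → con 1ℚ :+ con 0ℚ :* y := con 1ℚ) refl y)
bernoulli {y} 0≤1+y (suc n) = ℚ.≤-trans
  (≤-+ (trans (solve 2 (λ y k → (con 1ℚ :+ y) :* (con 1ℚ :+ k :* y) := con 1ℚ :+ (con 1ℚ :+ k) :* y :+ k :* (y :* y)) refl y (fromℕ n))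
              (cong (λ k → 1ℚ + k * y + fromℕ n * (y * y)) (sym (fromℕ-suc n))))
       (0≤* (0≤fromℕ n) (0≤p*p y)))
  (*-monoʳ 0≤1+y (bernoulli 0≤1+y n))

-- The bound `(1 - p) ^ n ≤ 1 / (1 + n p)` without division. The induction rests on `(1 - x)(1 + (n
-- + 1) x) = 1 + n x - (n + 1) x²`.
bernoulli⁻¹ : 0ℚ ≤ 1ℚ - p → 0ℚ ≤ p → ∀ n → (1ℚ - p) ^ n * (1ℚ + fromℕ n * p) ≤ 1ℚ
bernoulli⁻¹ {x} 0≤1-x 0≤x zero = ℚ.≤-reflexive (solve 1 (λ x → con 1ℚ :* (con 1ℚ :+ con 0ℚ :* x) := con 1ℚ) refl x)
bernoulli⁻¹ {x} 0≤1-x 0≤x (suc n) = begin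
  (1ℚ - x) * P * (1ℚ + fromℕ (suc n) * x)  ≡⟨ cong (λ k → (1ℚ - x) * P * (1ℚ + k * x)) (fromℕ-suc n) ⟩
  (1ℚ - x) * P * (1ℚ + (1ℚ + k) * x)       ≤⟨ ≤-+ (solve 3 (λ x p k → p :* (con 1ℚ :+ k :* x) := (con 1ℚ :- x) :* p :* (con 1ℚ :+ (con 1ℚ :+ k) :* x) :+ (con 1ℚ :+ k) :* (p :* (x :* x))) refl x P k)
                                                 (0≤* (0≤+ 0≤1 (0≤fromℕ n)) (0≤* (0≤^ 0≤1-x n) (0≤p*p x))) ⟩
  P * (1ℚ + k * x)                         ≤⟨ bernoulli⁻¹ 0≤1-x 0≤x n ⟩
  1ℚ                                       ∎
  where
  open ℚ.≤-Reasoning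
  P k : ℚ
  P = (1ℚ - x) ^ n
  k = fromℕ n

-- Counts over independent draws

𝔼-total : ∀ (μ : Mean Ω) (F : Ω → Ω′ → ℕ) b m →
          𝔼 (iid μ m) (λ xs → fromℕ (total (map F xs) b)) ≡ fromℕ m * 𝔼 μ (λ x → fromℕ (F x b))
𝔼-total μ F b zero    = sym (ℚ.*-zeroˡ (𝔼 μ (λ x → fromℕ (F x b))))
𝔼-total μ F b (suc m) = begin
  𝔼 μ (λ x → 𝔼 (iid μ m) (λ xs → fromℕ (F x b ℕ.+ total (map F xs) b)))
    ≡⟨ 𝔼-cong μ (λ x → 𝔼-cong (iid μ m) (λ xs → fromℕ-+ (F x b) (total (map F xs) b))) ⟩
  𝔼 μ (λ x → 𝔼 (iid μ m) (λ xs → fromℕ (F x b) + fromℕ (total (map F xs) b)))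
    ≡⟨ 𝔼-cong μ (λ x → trans (𝔼-+ (iid μ m) _ _)
         (cong₂ _+_ (𝔼-const (iid μ m) (fromℕ (F x b))) (𝔼-total μ F b m))) ⟩
  𝔼 μ (λ x → fromℕ (F x b) + fromℕ m * e)
    ≡⟨ trans (𝔼-+ μ _ _) (cong (e +_) (𝔼-const μ (fromℕ m * e))) ⟩
  e + fromℕ m * e
    ≡⟨ solve 2 (λ e k → e :+ k :* e := (con 1ℚ :+ k) :* e) refl e (fromℕ m) ⟩
  (1ℚ + fromℕ m) * e
    ≡⟨ cong (_* e) (fromℕ-suc m) ⟨
  fromℕ (suc m) * e ∎
  where
  open ≡-Reasoning
  e = 𝔼 μ (λ x → fromℕ (F x b))

-- Independence makes the exponential moment of a sum factorise, as in the proof of Chernoff bounds.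
𝔼-^total : ∀ β (μ : Mean Ω) (F : Ω → Ω′ → ℕ) b m →
           𝔼 (iid μ m) (λ xs → β ^ total (map F xs) b) ≡ 𝔼 μ (λ x → β ^ F x b) ^ m
𝔼-^total β μ F b zero    = refl
𝔼-^total β μ F b (suc m) = begin
  𝔼 μ (λ x → 𝔼 (iid μ m) (λ xs → β ^ (F x b ℕ.+ total (map F xs) b)))
    ≡⟨ 𝔼-cong μ (λ x → trans (𝔼-cong (iid μ m) (λ xs → ^-homo-* β (F x b) (total (map F xs) b)))
                              (trans (𝔼-*ˡ (iid μ m) (β ^ F x b) _) (cong (β ^ F x b *_) (𝔼-^total β μ F b m)))) ⟩
  𝔼 μ (λ x → β ^ F x b * e ^ m)
    ≡⟨ 𝔼-*ʳ μ (e ^ m) _ ⟩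
  e * e ^ m ∎
  where
  open ≡-Reasoning
  e = 𝔼 μ (λ x → β ^ F x b)

-- A property of some x is thus at most K times as likely as that of a random x:
-- this is the form in which the union bound is used.
Atoms≥ : Mean Ω → ℚ → Set
Atoms≥ {Ω} μ K = ∀ (f : Ω → ℚ) → (∀ x → 0ℚ ≤ f x) → ∀ x → f x ≤ K * 𝔼 μ f

atoms-uniform : ∀ n .{{_ : NonZero n}} → Atoms≥ (uniform n) (fromℕ n)
atoms-uniform n f 0≤f i = subst (f i ≤_) (sym (average-* n f)) (term≤sum 0≤f i)

atoms-iid : ∀ {μ : Mean Ω} {K} → 0ℚ ≤ K → Atoms≥ μ K → ∀ n → Atoms≥ (iid μ n) (K ^ n)
atoms-iid {μ = μ} 0≤K atoms zero    f 0≤f []       = ℚ.≤-reflexive (sym (ℚ.*-identityˡ (f [])))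
atoms-iid {μ = μ} {K} 0≤K atoms (suc n) f 0≤f (x ∷ xs) = begin
  f (x ∷ xs)                                              ≤⟨ atoms-iid 0≤K atoms n (λ ys → f (x ∷ ys)) (λ ys → 0≤f (x ∷ ys)) xs ⟩
  K ^ n * 𝔼 (iid μ n) (λ ys → f (x ∷ ys))                 ≤⟨ *-monoʳ (0≤^ 0≤K n) (atoms (λ y → 𝔼 (iid μ n) (λ ys → f (y ∷ ys))) (λ y → 0≤𝔼 (iid μ n) (λ ys → 0≤f (y ∷ ys))) x) ⟩
  K ^ n * (K * 𝔼 (iid μ (suc n)) f)                       ≡⟨ solve 3 (λ a b c → a :* (b :* c) := b :* a :* c) refl (K ^ n) K (𝔼 (iid μ (suc n)) f) ⟩
  K * K ^ n * 𝔼 (iid μ (suc n)) f                         ∎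
  where open ℚ.≤-Reasoning

-- Exchange with an arbitrary outer mean, established along the construction of `ν` from uniform
-- means by `iid`.
Fubini : Mean Ω′ → Set₁
Fubini {Ω′} ν = ∀ {Ω : Set} (μ : Mean Ω) (f : Ω → Ω′ → ℚ) →
  𝔼 μ (λ x → 𝔼 ν (f x)) ≡ 𝔼 ν (λ y → 𝔼 μ (λ x → f x y))

fubini-uniform : ∀ n .{{_ : NonZero n}} → Fubini (uniform n)
fubini-uniform n μ = 𝔼-swap μ n

fubini-iid : ∀ {ν : Mean Ω′} → Fubini ν → ∀ n → Fubini (iid ν n)
fubini-iid fub zero    μ f = refl
fubini-iid {ν = ν} fub (suc n) μ f =
  trans (fub μ (λ x y → 𝔼 (iid ν n) (λ ys → f x (y ∷ ys))))
        (𝔼-cong ν (λ y → fubini-iid fub n μ (λ x ys → f x (y ∷ ys))))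

-- A conflict is 0 or 1, and on these two values `β ^ x` is affine in `x`; so its mean is determined
-- by the cost.
conflict-^ : ∀ {N} β l (a b : Fin N) → β ^ conflict l a b ≡ 1ℚ - (1ℚ - β) * fromℕ (conflict l a b)
conflict-^ β nothing       a b = solve 1 (λ β → con 1ℚ := con 1ℚ :- (con 1ℚ :- β) :* con 0ℚ) refl β
conflict-^ β (just Sign.+) a b with a Fin.≟ b
... | yes _ = solve 1 (λ β → con 1ℚ := con 1ℚ :- (con 1ℚ :- β) :* con 0ℚ) refl β
... | no  _ = solve 1 (λ β → β :* con 1ℚ := con 1ℚ :- (con 1ℚ :- β) :* con 1ℚ) refl β
conflict-^ β (just Sign.-) a b with a Fin.≟ b
... | yes _ = solve 1 (λ β → β :* con 1ℚ := con 1ℚ :- (con 1ℚ :- β) :* con 1ℚ) refl β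
... | no  _ = solve 1 (λ β → con 1ℚ := con 1ℚ :- (con 1ℚ :- β) :* con 0ℚ) refl β

-- `a` times the failure indicator is either 0 or `a`, so `a` has to be bounded only in the event
-- that makes the tester fail.
halt-reject : ∀ {N} {P : Set} (G : SignedGraph N) a (P? : Dec P) → (P → a ≤ q) → 0ℚ ≤ q →
              a * (1ℚ - probability false G (halt (does P?))) ≤ q
halt-reject {q} G a (yes p) a≤q 0≤q =
  subst (_≤ q) (solve 1 (λ a → a := a :* (con 1ℚ :- con 0ℚ)) refl a) (a≤q p)
halt-reject {q} G a (no ¬p) a≤q 0≤q =
  subst (_≤ q) (solve 1 (λ a → con 0ℚ := a :* (con 1ℚ :- con 1ℚ)) refl a) 0≤q

halt-accept : ∀ {N} {P : Set} (G : SignedGraph N) a (P? : Dec P) → (¬ P → a ≤ q) → 0ℚ ≤ q →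
              a * (1ℚ - probability true G (halt (does P?))) ≤ q
halt-accept {q} G a (no ¬p) a≤q 0≤q =
  subst (_≤ q) (solve 1 (λ a → a := a :* (con 1ℚ :- con 0ℚ)) refl a) (a≤q ¬p)
halt-accept {q} G a (yes p) a≤q 0≤q =
  subst (_≤ q) (solve 1 (λ a → con 0ℚ := a :* (con 1ℚ :- con 1ℚ)) refl a) 0≤q

-- Probabilities of rejecting far and accepting close graphs

module _ (N : ℕ) .{{_ : NonZero N}} (part : Fin N → ℕ) (t r m threshold : ℕ) where
  open Tester N part t r m threshold
  open Extension part t

  private
    colorings : Mean Coloring
    colorings = iid (iid (uniform N) t) r

    pairs : Mean (Vec (Fin N × Fin N) m)
    pairs = iid (uniform N ⊗ uniform N) m

    -- The number of guesses, that is, the factor lost in the union bound.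
    K : ℚ
    K = (fromℕ N ^ t) ^ r

    X : SignedGraph N → Sample → Vec (Fin N × Fin N) m → Coloring → ℕ
    X G U ps π = total (observed G U ps) π

  𝔼-X : ∀ G U π → 𝔼 pairs (λ ps → fromℕ (X G U ps π)) ≡ fromℕ m * cost G (extend G U π)
  𝔼-X G U π = 𝔼-total (uniform N ⊗ uniform N) (λ p → value (inspectConflict U p) G) π m

  𝔼-β^X : ∀ β G U π → 𝔼 pairs (λ ps → β ^ X G U ps π) ≡ (1ℚ - (1ℚ - β) * cost G (extend G U π)) ^ m
  𝔼-β^X β G U π = trans
    (𝔼-^total β μ F π m)
    (cong (_^ m) (begin
      𝔼 μ (λ p → β ^ F p π)                                  ≡⟨ 𝔼-cong μ (λ (v , w) → conflict-^ β (label G v w) (extend G U π v) (extend G U π w)) ⟩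
      𝔼 μ (λ p → 1ℚ - (1ℚ - β) * fromℕ (F p π))              ≡⟨ 𝔼-- μ _ _ ⟩
      𝔼 μ (λ p → 1ℚ) - 𝔼 μ (λ p → (1ℚ - β) * fromℕ (F p π))  ≡⟨ cong₂ _-_ (𝔼-1 μ) (𝔼-*ˡ μ (1ℚ - β) _) ⟩
      1ℚ - (1ℚ - β) * cost G (extend G U π)                  ∎))
    where
    open ≡-Reasoning
    μ = uniform N ⊗ uniform N
    F : Fin N × Fin N → Coloring → ℕ
    F p = value (inspectConflict U p) G

  module _ (G : SignedGraph N) (β δ : ℚ) (0≤β : 0ℚ ≤ β) (β≤1 : β ≤ 1ℚ)
           (far : ∀ c → δ ≤ cost G c) (cost≤1 : ∀ c → cost G c ≤ 1ℚ) where

    -- Chernoff and union bound for each fixed sample `U`. Acceptance yields a guess with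
    -- `X < threshold`, hence `β ^ threshold ≤ β ^ X`; the sum over all guesses costs the factor
    -- `K`, and each moment is an `m`-th power. No sample is bad here, as every colouring has cost
    -- at least `δ`.
    reject-far : β ^ threshold * (1ℚ - probability false G tester) ≤ K * (1ℚ - (1ℚ - β) * δ) ^ m
    reject-far = begin
      a * (1ℚ - probability false G tester)
        ≡⟨ cong (λ p → a * (1ℚ - p)) (probability-tester false G) ⟩
      a * (1ℚ - 𝔼 S (λ U → 𝔼 pairs (D U)))
        ≡⟨ 𝔼-*-complement S a (λ U → 𝔼 pairs (D U)) ⟨
      𝔼 S (λ U → a * (1ℚ - 𝔼 pairs (D U)))
        ≤⟨ 𝔼-mono S fixed ⟩
      𝔼 S (λ U → K * (1ℚ - (1ℚ - β) * δ) ^ m)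
        ≡⟨ 𝔼-const S (K * (1ℚ - (1ℚ - β) * δ) ^ m) ⟩
      K * (1ℚ - (1ℚ - β) * δ) ^ m ∎
      where
      open ℚ.≤-Reasoning
      a = β ^ threshold
      S = mean drawSample
      D : Sample → Vec (Fin N × Fin N) m → ℚ
      D U ps = probability false G (decide (observed G U ps))
      0≤K : 0ℚ ≤ K
      0≤K = 0≤^ (0≤^ (0≤fromℕ N) t) r
      0≤1-β : 0ℚ ≤ 1ℚ - β
      0≤1-β = ≤⇒0≤- β≤1

      union : ∀ U ps → a * (1ℚ - D U ps) ≤ K * 𝔼 colorings (λ π → β ^ X G U ps π)
      union U ps = halt-reject G a (accepting? (observed G U ps))
        (λ (π , X<T) → ℚ.≤-trans (^-antitone 0≤β β≤1 (ℕ.<⇒≤ X<T))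
          (atoms-iid (0≤^ (0≤fromℕ N) t) (atoms-iid (0≤fromℕ N) (atoms-uniform N) t) r
            (λ π → β ^ X G U ps π) (λ π → 0≤^ 0≤β (X G U ps π)) π))
        (0≤* 0≤K (0≤𝔼 colorings (λ π → 0≤^ 0≤β (X G U ps π))))

      fixed : ∀ U → a * (1ℚ - 𝔼 pairs (D U)) ≤ K * (1ℚ - (1ℚ - β) * δ) ^ m
      fixed U = begin
        a * (1ℚ - 𝔼 pairs (D U))
          ≡⟨ 𝔼-*-complement pairs a (D U) ⟨
        𝔼 pairs (λ ps → a * (1ℚ - D U ps))
          ≤⟨ 𝔼-mono pairs (union U) ⟩
        𝔼 pairs (λ ps → K * 𝔼 colorings (λ π → β ^ X G U ps π))
          ≡⟨ 𝔼-*ˡ pairs K (λ ps → 𝔼 colorings (λ π → β ^ X G U ps π)) ⟩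
        K * 𝔼 pairs (λ ps → 𝔼 colorings (λ π → β ^ X G U ps π))
          -- After the exchange the guess is fixed before the pairs are drawn, so that the
          -- independence of the pairs applies.
          ≡⟨ cong (K *_) (fubini-iid (fubini-iid (fubini-uniform N) t) r pairs (λ ps π → β ^ X G U ps π)) ⟩
        K * 𝔼 colorings (λ π → 𝔼 pairs (λ ps → β ^ X G U ps π))
          ≤⟨ *-monoʳ 0≤K (𝔼-mono colorings bound) ⟩
        K * 𝔼 colorings (λ π → (1ℚ - (1ℚ - β) * δ) ^ m)
          ≡⟨ cong (K *_) (𝔼-const colorings ((1ℚ - (1ℚ - β) * δ) ^ m)) ⟩
        K * (1ℚ - (1ℚ - β) * δ) ^ m ∎
        where
        bound : ∀ π → 𝔼 pairs (λ ps → β ^ X G U ps π) ≤ (1ℚ - (1ℚ - β) * δ) ^ m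
        bound π = begin
          𝔼 pairs (λ ps → β ^ X G U ps π)                ≡⟨ 𝔼-β^X β G U π ⟩
          (1ℚ - (1ℚ - β) * cost G (extend G U π)) ^ m    ≤⟨ ^-monoˡ nonneg (ℚ.+-monoʳ-≤ 1ℚ (ℚ.neg-antimono-≤ (*-monoʳ 0≤1-β (far (extend G U π))))) m ⟩
          (1ℚ - (1ℚ - β) * δ) ^ m                        ∎
          where
          price = cost G (extend G U π)
          nonneg : 0ℚ ≤ 1ℚ - (1ℚ - β) * price
          -- Powers are monotone on nonnegative bases only; here `cost≤1` enters, through
          -- `β + (1 - β)(1 - price)`.
          nonneg = subst (0ℚ ≤_)
            (solve 2 (λ β p → β :+ (con 1ℚ :- β) :* (con 1ℚ :- p) := con 1ℚ :- (con 1ℚ :- β) :* p) refl β price)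
            (0≤+ 0≤β (0≤* 0≤1-β (≤⇒0≤- (cost≤1 (extend G U π)))))

  module _ (G : SignedGraph N) (choose : Sample → Coloring) (η : ℚ)
           (close : 𝔼 (mean drawSample) (λ U → cost G (extend G U (choose U))) ≤ η) where

    -- Markov's inequality over samples and pairs together: rejection forces the count of the
    -- particular guess `choose U` up to `threshold`. The guess may depend on an unknown clustering,
    -- because the tester searches all of them.
    accept-close : fromℕ threshold * (1ℚ - probability true G tester) ≤ fromℕ m * η
    accept-close = begin
      T * (1ℚ - probability true G tester)
        ≡⟨ cong (λ p → T * (1ℚ - p)) (probability-tester true G) ⟩
      T * (1ℚ - 𝔼 S (λ U → 𝔼 pairs (D U)))
        ≡⟨ 𝔼-*-complement S T (λ U → 𝔼 pairs (D U)) ⟨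
      𝔼 S (λ U → T * (1ℚ - 𝔼 pairs (D U)))
        ≤⟨ 𝔼-mono S fixed ⟩
      𝔼 S (λ U → fromℕ m * cost G (extend G U (choose U)))
        ≡⟨ 𝔼-*ˡ S (fromℕ m) (λ U → cost G (extend G U (choose U))) ⟩
      fromℕ m * 𝔼 S (λ U → cost G (extend G U (choose U)))
        ≤⟨ *-monoʳ (0≤fromℕ m) close ⟩
      fromℕ m * η ∎
      where
      open ℚ.≤-Reasoning
      T = fromℕ threshold
      S = mean drawSample
      D : Sample → Vec (Fin N × Fin N) m → ℚ
      D U ps = probability true G (decide (observed G U ps))

      markov : ∀ U ps → T * (1ℚ - D U ps) ≤ fromℕ (X G U ps (choose U))
      markov U ps = halt-accept G T (accepting? (observed G U ps))
        (λ ¬acc → fromℕ-mono {threshold} {X G U ps (choose U)} (ℕ.≮⇒≥ (λ X<T → ¬acc (choose U , X<T))))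
        (0≤fromℕ (X G U ps (choose U)))

      fixed : ∀ U → T * (1ℚ - 𝔼 pairs (D U)) ≤ fromℕ m * cost G (extend G U (choose U))
      fixed U = begin
        T * (1ℚ - 𝔼 pairs (D U))
          ≡⟨ 𝔼-*-complement pairs T (D U) ⟨
        𝔼 pairs (λ ps → T * (1ℚ - D U ps))
          ≤⟨ 𝔼-mono pairs (markov U) ⟩
        𝔼 pairs (λ ps → fromℕ (X G U ps (choose U)))
          ≡⟨ 𝔼-X G U (choose U) ⟩
        fromℕ m * cost G (extend G U (choose U)) ∎

2ℚ : ℚ
2ℚ = fromℕ 2

-- Greedy recolouring

sumOver : ∀ {n} → (Ω → ℚ) → Vec Ω n → ℚ
sumOver g []       = 0ℚ
sumOver g (x ∷ xs) = g x + sumOver g xs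

score-map : ∀ {n N} (f : Ω → Maybe Sign) (c : Ω → Fin N) a (xs : Vec Ω n) →
            score (map f xs) (map c xs) a ≡ sumOver (λ x → signℚ (f x) * eq (c x) a) xs
score-map f c a []       = refl
score-map f c a (x ∷ xs) = cong (signℚ (f x) * eq (c x) a +_) (score-map f c a xs)

-- The variance of an independent sum is additive, and each variance is at most the second moment.
variance-sum : ∀ (μ : Mean Ω) (g : Ω → ℚ) n →
  𝔼 (iid μ n) (λ xs → (sumOver g xs - fromℕ n * 𝔼 μ g) * (sumOver g xs - fromℕ n * 𝔼 μ g))
    ≤ fromℕ n * 𝔼 μ (λ x → g x * g x)
variance-sum μ g zero = ℚ.≤-reflexive
  (solve 2 (λ e s → (con 0ℚ :- con 0ℚ :* e) :* (con 0ℚ :- con 0ℚ :* e) := con 0ℚ :* s) refl (𝔼 μ g) (𝔼 μ (λ x → g x * g x)))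
variance-sum {Ω} μ g (suc n) = begin
  𝔼 μ (λ x → 𝔼 ν (λ xs → (g x + sumOver g xs - fromℕ (suc n) * e) * (g x + sumOver g xs - fromℕ (suc n) * e)))
    ≡⟨ 𝔼-cong μ (λ x → trans (𝔼-cong ν (λ xs → expand x xs))
         (trans (𝔼-+ ν _ (λ xs → R xs * R xs)) (cong (_+ V) (trans (𝔼-+ ν _ _)
           (cong₂ _+_ (𝔼-const ν (a x * a x)) (𝔼-*ˡ ν (2ℚ * a x) R)))))) ⟩
  𝔼 μ (λ x → a x * a x + 2ℚ * a x * ρ + V)
    ≡⟨ 𝔼-cong μ (λ x → solve 4 (λ g e r v → (g :- e) :* (g :- e) :+ con 2ℚ :* (g :- e) :* r :+ v
         := g :* g :+ (con 2ℚ :* (r :- e) :* g :+ (e :* e :- con 2ℚ :* e :* r :+ v))) refl (g x) e ρ V) ⟩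
  𝔼 μ (λ x → g x * g x + (2ℚ * (ρ - e) * g x + d))
    ≡⟨ trans (𝔼-+ μ _ _) (cong (s +_) (trans (𝔼-+ μ _ _) (cong₂ _+_ (𝔼-*ˡ μ (2ℚ * (ρ - e)) g) (𝔼-const μ d)))) ⟩
  s + (2ℚ * (ρ - e) * e + d)
    -- The cross term cancels whatever the value of `ρ`, since `a` has mean zero; dropping `e * e`
    -- passes from the variance to the second moment.
    ≤⟨ ≤-+ (solve 4 (λ s e r v → s :+ v := s :+ (con 2ℚ :* (r :- e) :* e :+ (e :* e :- con 2ℚ :* e :* r :+ v)) :+ e :* e) refl s e ρ V) (0≤p*p e) ⟩
  s + V
    ≤⟨ ℚ.+-monoʳ-≤ s (variance-sum μ g n) ⟩
  s + fromℕ n * s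
    ≡⟨ trans (solve 2 (λ s n → s :+ n :* s := (con 1ℚ :+ n) :* s) refl s (fromℕ n)) (cong (_* s) (sym (fromℕ-suc n))) ⟩
  fromℕ (suc n) * s ∎
  where
  open ℚ.≤-Reasoning
  ν : Mean (Vec Ω n)
  ν = iid μ n
  e ρ V s d : ℚ
  e = 𝔼 μ g
  a : Ω → ℚ
  a x = g x - e
  R : Vec Ω n → ℚ
  R xs = sumOver g xs - fromℕ n * e
  ρ = 𝔼 ν R
  V = 𝔼 ν (λ xs → R xs * R xs)
  s = 𝔼 μ (λ x → g x * g x)
  d = e * e - 2ℚ * e * ρ + V
  expand : ∀ x xs → (g x + sumOver g xs - fromℕ (suc n) * e) * (g x + sumOver g xs - fromℕ (suc n) * e)
                  ≡ a x * a x + 2ℚ * a x * R xs + R xs * R xs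
  expand x xs = trans (cong (λ k → (g x + sumOver g xs - k * e) * (g x + sumOver g xs - k * e)) (fromℕ-suc n))
    (solve 4 (λ g s e n → (g :+ s :- (con 1ℚ :+ n) :* e) :* (g :+ s :- (con 1ℚ :+ n) :* e)
        := (g :- e) :* (g :- e) :+ con 2ℚ :* (g :- e) :* (s :- n :* e) :+ (s :- n :* e) :* (s :- n :* e))
      refl (g x) (sumOver g xs) e (fromℕ n))

eq-comm : ∀ {n} (a b : Fin n) → eq a b ≡ eq b a
eq-comm a b with a Fin.≟ b | b Fin.≟ a
... | yes _   | yes _   = refl
... | no _    | no _    = refl
... | yes a≡b | no b≢a  with () ← b≢a (sym a≡b)
... | no a≢b  | yes b≡a with () ← a≢b (sym b≡a)

0≤𝟙 : ∀ b → 0ℚ ≤ 𝟙 b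
0≤𝟙 true  = 0≤1
0≤𝟙 false = ℚ.≤-refl

𝟙≤1 : ∀ b → 𝟙 b ≤ 1ℚ
𝟙≤1 true  = ℚ.≤-refl
𝟙≤1 false = 0≤1

𝟙-idem : ∀ b → 𝟙 b * 𝟙 b ≡ 𝟙 b
𝟙-idem true  = refl
𝟙-idem false = refl

sum-eq : ∀ {n} (a : Fin n) → Sumℚ.sum (eq a) ≡ 1ℚ
sum-eq {suc n} zero    = cong (1ℚ +_) (trans (sum-const n 0ℚ) (ℚ.*-zeroʳ (fromℕ n)))
sum-eq {suc n} (suc a) = trans (ℚ.+-identityˡ _) (sum-eq a)

weight : Maybe Sign → ℚ
weight l = signℚ l * signℚ l

weight≤1 : ∀ l → weight l ≤ 1ℚ
weight≤1 nothing       = 0≤1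
weight≤1 (just Sign.+) = ℚ.≤-refl
weight≤1 (just Sign.-) = ℚ.≤-refl

-- Each error x is bounded through 2 r x ≤ r² + x².
young : ∀ {r sb sg xb xg E} → 0ℚ ≤ r → sb ≤ sg → xb * xb ≤ E → xg * xg ≤ E →
        2ℚ * (r * ((sb - xb) - (sg - xg))) ≤ 2ℚ * (r * r + E)
young {r} {sb} {sg} {xb} {xg} {E} 0≤r sb≤sg xb²≤E xg²≤E =
  ≤-+ (solve 6 (λ r sb sg xb xg E →
        con 2ℚ :* (r :* r :+ E) := con 2ℚ :* (r :* ((sb :- xb) :- (sg :- xg)))
          :+ (con 2ℚ :* (r :* (sg :- sb))
           :+ ((r :+ xb) :* (r :+ xb) :+ ((r :- xg) :* (r :- xg) :+ ((E :- xb :* xb) :+ (E :- xg :* xg)))))) refl r sb sg xb xg E)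
      (0≤+ (0≤* (0≤fromℕ 2) (0≤* 0≤r (≤⇒0≤- sb≤sg)))
        (0≤+ (0≤p*p (r + xb)) (0≤+ (0≤p*p (r - xg)) (0≤+ (≤⇒0≤- xb²≤E) (≤⇒0≤- xg²≤E)))))

module _ {N : ℕ} .{{_ : NonZero N}} (G : SignedGraph N) where

  -- The expected contribution of one random sample node to the score of colour `a` at `v`; a sample
  -- of size `t` has mean score `t` times this.
  gain : (Fin N → Fin N) → Fin N → Fin N → ℚ
  gain c v a = 𝔼 (uniform N) (λ w → signℚ (label G v w) * eq (c w) a)

  module _ (c : Fin N → Fin N) (v : Fin N) (t : ℕ) where
    private
      samples : Mean (Vec (Fin N) t)
      samples = iid (uniform N) t

    choice : Vec (Fin N) t → Fin N
    choice U = greedy v (map (label G v) U) (map c U)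

    scoreOf error : Vec (Fin N) t → Fin N → ℚ
    scoreOf U a = score (map (label G v) U) (map c U) a
    error U a = scoreOf U a - fromℕ t * gain c v a

    errorSum : Vec (Fin N) t → ℚ
    errorSum U = Sumℚ.sum (λ a → error U a * error U a)

    -- A sample node has just one colour and so adds to the second moment of one colour only. The
    -- number of colours therefore drops out after summation.
    𝔼-errorSum : 𝔼 samples errorSum ≤ fromℕ t
    𝔼-errorSum = begin
      𝔼 samples errorSum
        ≡⟨ 𝔼-sum samples (λ a U → error U a * error U a) ⟩
      Sumℚ.sum (λ a → 𝔼 samples (λ U → error U a * error U a))
        ≤⟨ sum-mono perColour ⟩
      Sumℚ.sum (λ a → fromℕ t * 𝔼 (uniform N) (λ w → g a w * g a w))
        ≡⟨ SumRing.*-distribˡ-sum (fromℕ t) (λ a → 𝔼 (uniform N) (λ w → g a w * g a w)) ⟨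
      fromℕ t * Sumℚ.sum (λ a → 𝔼 (uniform N) (λ w → g a w * g a w))
        ≡⟨ cong (fromℕ t *_) (𝔼-sum (uniform N) (λ a w → g a w * g a w)) ⟨
      fromℕ t * 𝔼 (uniform N) (λ w → Sumℚ.sum (λ a → g a w * g a w))
        ≤⟨ *-monoʳ (0≤fromℕ t) (𝔼-mono (uniform N) λ w → ℚ.≤-trans (sum-mono (λ a → squared (label G v w) (c w) a)) (ℚ.≤-reflexive (sum-eq (c w)))) ⟩
      fromℕ t * 𝔼 (uniform N) (λ w → 1ℚ)
        ≡⟨ trans (cong (fromℕ t *_) (𝔼-1 (uniform N))) (ℚ.*-identityʳ (fromℕ t)) ⟩
      fromℕ t ∎
      where
      open ℚ.≤-Reasoning
      g : Fin N → Fin N → ℚ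
      g a w = signℚ (label G v w) * eq (c w) a
      perColour : ∀ a → 𝔼 samples (λ U → error U a * error U a) ≤ fromℕ t * 𝔼 (uniform N) (λ w → g a w * g a w)
      perColour a = ℚ.≤-trans
        (ℚ.≤-reflexive (𝔼-cong samples (λ U → cong (λ s → (s - fromℕ t * gain c v a) * (s - fromℕ t * gain c v a)) (score-map (label G v) c a U))))
        (variance-sum (uniform N) (g a) t)
      squared : ∀ l (b a : Fin N) → signℚ l * eq b a * (signℚ l * eq b a) ≤ eq b a
      squared l b a = begin
        signℚ l * eq b a * (signℚ l * eq b a)  ≡⟨ solve 2 (λ s e → s :* e :* (s :* e) := s :* s :* (e :* e)) refl (signℚ l) (eq b a) ⟩
        weight l * (eq b a * eq b a)           ≡⟨ cong (weight l *_) (𝟙-idem (does (b Fin.≟ a))) ⟩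
        weight l * eq b a                      ≤⟨ *-monoˡ (0≤𝟙 (does (b Fin.≟ a))) (weight≤1 l) ⟩
        1ℚ * eq b a                            ≡⟨ ℚ.*-identityˡ (eq b a) ⟩
        eq b a                                 ∎

    -- The chosen colour depends on the sample, so its error is controlled through the sum over all
    -- colours. The greedy rule compares scores, and a score is `t` times the gain plus an error.
    greedy-loss : ∀ {r} → 0ℚ ≤ r → ∀ U b →
      2ℚ * (r * (fromℕ t * (gain c v b - gain c v (choice U)))) ≤ 2ℚ * (r * r + errorSum U)
    greedy-loss {r} 0≤r U b = subst (λ z → 2ℚ * (r * z) ≤ 2ℚ * (r * r + errorSum U))
      (solve 5 (λ t sb sg fb fg → (sb :- (sb :- t :* fb)) :- (sg :- (sg :- t :* fg)) := t :* (fb :- fg)) refl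
        (fromℕ t) (scoreOf U b) (scoreOf U (choice U)) (gain c v b) (gain c v (choice U)))
      (young 0≤r (argmax-max v (scoreOf U) b) (square≤ b) (square≤ (choice U)))
      where
      square≤ : ∀ a → error U a * error U a ≤ errorSum U
      square≤ a = term≤sum {f = λ a → error U a * error U a} (λ a → 0≤p*p (error U a)) a

    𝔼-greedy-loss : ∀ (r : ℕ) → 2ℚ * (fromℕ r * (fromℕ t * 𝔼 samples (λ U → gain c v (c v) - gain c v (choice U))))
                    ≤ 2ℚ * (fromℕ r * fromℕ r + fromℕ t)
    𝔼-greedy-loss r = begin
      2ℚ * (fromℕ r * (fromℕ t * 𝔼 samples L))
        ≡⟨ trans (𝔼-*ˡ samples 2ℚ _) (cong (2ℚ *_) (trans (𝔼-*ˡ samples (fromℕ r) _) (cong (fromℕ r *_) (𝔼-*ˡ samples (fromℕ t) L)))) ⟨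
      𝔼 samples (λ U → 2ℚ * (fromℕ r * (fromℕ t * L U)))
        ≤⟨ 𝔼-mono samples (λ U → greedy-loss (0≤fromℕ r) U (c v)) ⟩
      𝔼 samples (λ U → 2ℚ * (fromℕ r * fromℕ r + errorSum U))
        ≡⟨ trans (𝔼-*ˡ samples 2ℚ _) (cong (2ℚ *_) (trans (𝔼-+ samples _ errorSum) (cong (_+ 𝔼 samples errorSum) (𝔼-const samples (fromℕ r * fromℕ r))))) ⟩
      2ℚ * (fromℕ r * fromℕ r + 𝔼 samples errorSum)
        ≤⟨ *-monoʳ (0≤fromℕ 2) (ℚ.+-monoʳ-≤ (fromℕ r * fromℕ r) 𝔼-errorSum) ⟩
      2ℚ * (fromℕ r * fromℕ r + fromℕ t) ∎
      where
      open ℚ.≤-Reasoning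
      L : Vec (Fin N) t → ℚ
      L U = gain c v (c v) - gain c v (choice U)

-- Change of the cost when one part is recoloured

plus : Maybe Sign → ℚ
plus (just Sign.+) = 1ℚ
plus _             = 0ℚ

conflict-linear : ∀ {N} l (a b : Fin N) → fromℕ (conflict l a b) ≡ plus l - signℚ l * eq a b
conflict-linear nothing       a b = solve 1 (λ e → con 0ℚ := con 0ℚ :- con 0ℚ :* e) refl (eq a b)
conflict-linear (just Sign.+) a b with a Fin.≟ b
... | yes _ = refl
... | no _  = refl
conflict-linear (just Sign.-) a b with a Fin.≟ b
... | yes _ = refl
... | no _  = refl

-- The second-order effect of moving both endpoints of a pair: a mixed difference of four indicators
-- lies between -2 and 2, and it vanishes off the edges.
interaction : ∀ l {p q u z} → 0ℚ ≤ p → p ≤ 1ℚ → 0ℚ ≤ q → q ≤ 1ℚ → 0ℚ ≤ u → u ≤ 1ℚ → 0ℚ ≤ z → z ≤ 1ℚ →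
              0ℚ ≤ signℚ l * (p + z - q - u) + 2ℚ * weight l
interaction nothing {p} {q} {u} {z} _ _ _ _ _ _ _ _ =
  ℚ.≤-reflexive (solve 4 (λ p q u z → con 0ℚ := con 0ℚ :* (p :+ z :- q :- u) :+ con 2ℚ :* con 0ℚ) refl p q u z)
interaction (just Sign.+) {p} {q} {u} {z} 0≤p _ _ q≤1 _ u≤1 0≤z _ = subst (0ℚ ≤_)
  (solve 4 (λ p q u z → p :+ z :+ ((con 1ℚ :- q) :+ (con 1ℚ :- u)) := con 1ℚ :* (p :+ z :- q :- u) :+ con 2ℚ :* con 1ℚ) refl p q u z)
  (0≤+ (0≤+ 0≤p 0≤z) (0≤+ (≤⇒0≤- q≤1) (≤⇒0≤- u≤1)))
interaction (just Sign.-) {p} {q} {u} {z} _ p≤1 0≤q _ 0≤u _ _ z≤1 = subst (0ℚ ≤_)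
  (solve 4 (λ p q u z → q :+ u :+ ((con 1ℚ :- p) :+ (con 1ℚ :- z)) := con (- 1ℚ) :* (p :+ z :- q :- u) :+ con 2ℚ :* con 1ℚ) refl p q u z)
  (0≤+ (0≤+ 0≤q 0≤u) (0≤+ (≤⇒0≤- p≤1) (≤⇒0≤- z≤1)))

-- To first order the two endpoints act separately, each against the old colour of the other. The
-- correction arises only if both are recoloured.
conflict-update : ∀ {N} l (bv bw : Bool) (a a′ x x′ : Fin N) →
  fromℕ (conflict l (if bv then a′ else a) (if bw then x′ else x)) ≤
  fromℕ (conflict l a x)
    + (𝟙 bv * (signℚ l * eq x a - signℚ l * eq x a′) + 𝟙 bw * (signℚ l * eq a x - signℚ l * eq a x′))
    + 2ℚ * (𝟙 bv * (𝟙 bw * weight l))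
conflict-update l false false a a′ x x′ = ℚ.≤-reflexive
  (solve 6 (λ c s p q u y → c := c :+ (con 0ℚ :* (s :* p :- s :* q) :+ con 0ℚ :* (s :* u :- s :* y)) :+ con 2ℚ :* (con 0ℚ :* (con 0ℚ :* (s :* s)))) refl
    (fromℕ (conflict l a x)) (signℚ l) (eq x a) (eq x a′) (eq a x) (eq a x′))
conflict-update l true false a a′ x x′ rewrite conflict-linear l a x | conflict-linear l a′ x | eq-comm x a | eq-comm x a′ = ℚ.≤-reflexive
  (solve 5 (λ c s p q u → c :- s :* q := c :- s :* p :+ (con 1ℚ :* (s :* p :- s :* q) :+ con 0ℚ :* (s :* p :- s :* u)) :+ con 2ℚ :* (con 1ℚ :* (con 0ℚ :* (s :* s)))) refl
    (plus l) (signℚ l) (eq a x) (eq a′ x) (eq a x′))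
conflict-update l false true a a′ x x′ rewrite conflict-linear l a x | conflict-linear l a x′ = ℚ.≤-reflexive
  (solve 6 (λ c s p q u y → c :- s :* u := c :- s :* p :+ (con 0ℚ :* (s :* q :- s :* y) :+ con 1ℚ :* (s :* p :- s :* u)) :+ con 2ℚ :* (con 0ℚ :* (con 1ℚ :* (s :* s)))) refl
    (plus l) (signℚ l) (eq a x) (eq x a) (eq a x′) (eq x a′))
conflict-update l true true a a′ x x′ rewrite conflict-linear l a x | conflict-linear l a′ x′ | eq-comm x a | eq-comm x a′ = ≤-+
  (solve 6 (λ c s p q u z → c :- s :* p :+ (con 1ℚ :* (s :* p :- s :* q) :+ con 1ℚ :* (s :* p :- s :* u)) :+ con 2ℚ :* (con 1ℚ :* (con 1ℚ :* (s :* s)))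
      := c :- s :* z :+ (s :* (p :+ z :- q :- u) :+ con 2ℚ :* (s :* s))) refl
    (plus l) (signℚ l) (eq a x) (eq a′ x) (eq a x′) (eq a′ x′))
  (interaction l (0≤𝟙 (does (a Fin.≟ x))) (𝟙≤1 (does (a Fin.≟ x))) (0≤𝟙 (does (a′ Fin.≟ x))) (𝟙≤1 (does (a′ Fin.≟ x)))
                 (0≤𝟙 (does (a Fin.≟ x′))) (𝟙≤1 (does (a Fin.≟ x′))) (0≤𝟙 (does (a′ Fin.≟ x′))) (𝟙≤1 (does (a′ Fin.≟ x′))))

restrict : ∀ {P : Set} r x (P? : Dec P) → (P → r * x ≤ 1ℚ) → r * (𝟙 (does P?) * x) ≤ 𝟙 (does P?)
restrict r x (yes p) rx≤1 = subst (_≤ 1ℚ) (cong (r *_) (sym (ℚ.*-identityˡ x))) (rx≤1 p)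
restrict r x (no _)  _    = ℚ.≤-reflexive (solve 2 (λ r x → r :* (con 0ℚ :* x) := con 0ℚ) refl r x)

disjoint-≤ : ∀ {P Q R : Set} (P? : Dec P) (Q? : Dec Q) (R? : Dec R) →
             (P → ¬ Q) → (P → R) → (Q → R) → 𝟙 (does P?) + 𝟙 (does Q?) ≤ 𝟙 (does R?)
disjoint-≤ (yes p) (yes q) _       P→¬Q _ _ = contradiction q (P→¬Q p)
disjoint-≤ (yes p) (no _)  (yes _) _ _ _    = ℚ.≤-refl
disjoint-≤ (yes p) (no _)  (no ¬r) _ P→R _  = contradiction (P→R p) ¬r
disjoint-≤ (no _)  (yes q) (yes _) _ _ _    = ℚ.≤-refl
disjoint-≤ (no _)  (yes q) (no ¬r) _ _ Q→R  = contradiction (Q→R q) ¬r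
disjoint-≤ (no _)  (no _)  R?      _ _ _    = 0≤𝟙 (does R?)

decide-else : ∀ {P A B : Set} (P? : Dec P) (f : A → B) x {y z} → (¬ P → f y ≡ f z) →
              f (if does P? then x else y) ≡ f (if does P? then x else z)
decide-else (yes _) f x fy≡fz = refl
decide-else (no ¬p) f x fy≡fz = fy≡fz ¬p

inPart : (Fin n → ℕ) → ℕ → Fin n → Bool
inPart part i v = does (part v ℕ.≟ i)

module _ {N : ℕ} .{{_ : NonZero N}} (G : SignedGraph N) (part : Fin N → ℕ) where
  private
    nodes : Mean (Fin N)
    nodes = uniform N

  updateOn : ℕ → (g c : Fin N → Fin N) → Fin N → Fin N
  updateOn i g c v = if inPart part i v then g v else c v

  loss : (g c : Fin N → Fin N) → Fin N → ℚ
  loss g c v = gain G c v (c v) - gain G c v (g v)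

  -- Both endpoints of a pair contribute a first-order term. The two agree on average, as the graph
  -- is symmetric, which is why the loss occurs twice.
  cost-update : ∀ i g c → cost G (updateOn i g c) ≤
    cost G c + (𝔼 nodes (λ v → 𝟙 (inPart part i v) * loss g c v) + 𝔼 nodes (λ v → 𝟙 (inPart part i v) * loss g c v))
      + 2ℚ * 𝔼 nodes (λ v → 𝟙 (inPart part i v) * 𝔼 nodes (λ w → 𝟙 (inPart part i w) * weight (label G v w)))
  cost-update i g c = begin
    cost G (updateOn i g c)
      ≤⟨ 𝔼-mono nodes (λ v → 𝔼-mono nodes (λ w → conflict-update (label G v w) (inPart part i v) (inPart part i w) (c v) (g v) (c w) (g w))) ⟩
    𝔼 nodes (λ v → 𝔼 nodes (λ w → C v w + (P v w + Q v w) + 2ℚ * W v w))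
      ≡⟨ split (λ v w → C v w + (P v w + Q v w)) (λ v w → 2ℚ * W v w) ⟩
    𝔼 nodes (λ v → 𝔼 nodes (λ w → C v w + (P v w + Q v w))) + 𝔼 nodes (λ v → 𝔼 nodes (λ w → 2ℚ * W v w))
      ≡⟨ cong₂ _+_ (trans (split C (λ v w → P v w + Q v w)) (cong (cost G c +_) (trans (split P Q) (cong₂ _+_ PL QL)))) WL ⟩
    cost G c + (𝔼 nodes (λ v → 𝟙 (inPart part i v) * loss g c v) + 𝔼 nodes (λ v → 𝟙 (inPart part i v) * loss g c v))
      + 2ℚ * 𝔼 nodes (λ v → 𝟙 (inPart part i v) * 𝔼 nodes (λ w → 𝟙 (inPart part i w) * weight (label G v w))) ∎
    where
    open ℚ.≤-Reasoning
    s C P Q W : Fin N → Fin N → ℚ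
    s v w = signℚ (label G v w)
    C v w = fromℕ (conflict (label G v w) (c v) (c w))
    P v w = 𝟙 (inPart part i v) * (s v w * eq (c w) (c v) - s v w * eq (c w) (g v))
    Q v w = 𝟙 (inPart part i w) * (s v w * eq (c v) (c w) - s v w * eq (c v) (g w))
    W v w = 𝟙 (inPart part i v) * (𝟙 (inPart part i w) * weight (label G v w))

    split : ∀ (f h : Fin N → Fin N → ℚ) → 𝔼 nodes (λ v → 𝔼 nodes (λ w → f v w + h v w))
            ≡ 𝔼 nodes (λ v → 𝔼 nodes (f v)) + 𝔼 nodes (λ v → 𝔼 nodes (h v))
    split f h = trans (𝔼-cong nodes (λ v → 𝔼-+ nodes (f v) (h v)))
                      (𝔼-+ nodes (λ v → 𝔼 nodes (f v)) (λ v → 𝔼 nodes (h v)))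

    PL : 𝔼 nodes (λ v → 𝔼 nodes (P v)) ≡ 𝔼 nodes (λ v → 𝟙 (inPart part i v) * loss g c v)
    PL = 𝔼-cong nodes λ v → trans
      (𝔼-*ˡ nodes (𝟙 (inPart part i v)) (λ w → s v w * eq (c w) (c v) - s v w * eq (c w) (g v)))
      (cong (𝟙 (inPart part i v) *_) (𝔼-- nodes (λ w → s v w * eq (c w) (c v)) (λ w → s v w * eq (c w) (g v))))

    QL : 𝔼 nodes (λ v → 𝔼 nodes (Q v)) ≡ 𝔼 nodes (λ v → 𝟙 (inPart part i v) * loss g c v)
    QL = trans (𝔼-swap nodes N Q) (trans
      (𝔼-cong nodes λ w → 𝔼-cong nodes λ v → cong (λ l → 𝟙 (inPart part i w) * (signℚ l * eq (c v) (c w) - signℚ l * eq (c v) (g w))) (symmetric G v w))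
      PL)

    WL : 𝔼 nodes (λ v → 𝔼 nodes (λ w → 2ℚ * W v w)) ≡
         2ℚ * 𝔼 nodes (λ v → 𝟙 (inPart part i v) * 𝔼 nodes (λ w → 𝟙 (inPart part i w) * weight (label G v w)))
    WL = trans (𝔼-cong nodes λ v → trans (𝔼-*ˡ nodes 2ℚ (W v))
                 (cong (2ℚ *_) (𝔼-*ˡ nodes (𝟙 (inPart part i v)) (λ w → 𝟙 (inPart part i w) * weight (label G v w)))))
               (𝔼-*ˡ nodes 2ℚ (λ v → 𝟙 (inPart part i v) * 𝔼 nodes (λ w → 𝟙 (inPart part i w) * weight (label G v w))))

  module _ (r : ℕ) .{{_ : NonZero r}} where
    open Extension part (r ℕ.* r)

    private
      R : ℚ
      R = fromℕ r
      samples : Mean (Vec (Fin N) (r ℕ.* r))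
      samples = iid nodes (r ℕ.* r)

    greedyStep : ℕ → (Fin N → Fin N) → Vec (Fin N) (r ℕ.* r) → Fin N → Fin N
    greedyStep i c U = updateOn i (λ v → choice G c v (r ℕ.* r) U) c

    private
      L : (Fin N → Fin N) → Vec (Fin N) (r ℕ.* r) → Fin N → ℚ
      L c U = loss (λ v → choice G c v (r ℕ.* r) U) c

    -- The block size `r * r` balances the two terms of `𝔼-greedy-loss`: its sides become
    -- `2 r² · (r x)` and `2 r² · 2` for the expected loss `x`.
    𝔼-loss : ∀ c v → R * 𝔼 samples (λ U → L c U v) ≤ 2ℚ
    𝔼-loss c v = cancelˡ (0<* {2ℚ} {R * R} (fromℕ-pos 2) (0<* (fromℕ-pos r) (fromℕ-pos r)))
      (subst₂ _≤_
        (solve 2 (λ R x → con 2ℚ :* (R :* (R :* R :* x)) := con 2ℚ :* (R :* R) :* (R :* x)) refl R (𝔼 samples (λ U → L c U v)))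
        (solve 1 (λ R → con 2ℚ :* (R :* R :+ R :* R) := con 2ℚ :* (R :* R) :* con 2ℚ) refl R)
        (subst (λ t → 2ℚ * (R * (t * 𝔼 samples (λ U → L c U v))) ≤ 2ℚ * (R * R + t)) (fromℕ-* r r)
          (𝔼-greedy-loss G c v (r ℕ.* r) r)))

    -- Block i is coloured as in the clustering whose parts before i are already recoloured.
    hybrid : ∀ {l} → ℕ → (Fin N → Fin N) → Vec (Vec (Fin N) (r ℕ.* r)) l → Vec (Vec (Fin N) (r ℕ.* r)) l
    hybrid i c []       = []
    hybrid i c (U ∷ Us) = map c U ∷ hybrid (suc i) (greedyStep i c U) Us

    final : ∀ {l} → ℕ → (Fin N → Fin N) → Vec (Vec (Fin N) (r ℕ.* r)) l → Fin N → Fin N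
    final i c Us v = recolour v i (profile G Us v) (hybrid i c Us) (c v)

    -- Some remaining block serves `v` and overwrites its starting colour. Thus the tester, which
    -- starts from `v`, ends where the recolouring of the unknown `c` ends.
    recolour-default : ∀ {l} v i lss (bss : Vec (Vec (Fin N) (r ℕ.* r)) l) a b → i ℕ.≤ part v → part v ℕ.< i ℕ.+ l →
                       recolour v i lss bss a ≡ recolour v i lss bss b
    recolour-default v i []         []         a b i≤p p<i+l =
      contradiction (ℕ.≤-trans p<i+l (ℕ.≤-reflexive (ℕ.+-identityʳ i))) (ℕ.≤⇒≯ i≤p)
    recolour-default {suc l} v i (ls ∷ lss) (bs ∷ bss) a b i≤p p<i+l =
      decide-else (part v ℕ.≟ i) (recolour v (suc i) lss bss) (greedy v ls bs) λ p≢i →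
        recolour-default v (suc i) lss bss a b (ℕ.≤∧≢⇒< i≤p (λ i≡p → p≢i (sym i≡p)))
          (ℕ.≤-trans p<i+l (ℕ.≤-reflexive (ℕ.+-suc i l)))

    module _ (spread : ∀ v → fromℕ r * 𝔼 nodes (λ w → 𝟙 (inPart part (part v) w) * weight (label G v w)) ≤ 1ℚ) where

      inside≤ : ∀ i v → R * (𝟙 (inPart part i v) * 𝔼 nodes (λ w → 𝟙 (inPart part i w) * weight (label G v w))) ≤ 𝟙 (inPart part i v)
      inside≤ i v = restrict R (𝔼 nodes (λ w → 𝟙 (inPart part i w) * weight (label G v w))) (part v ℕ.≟ i) (λ { refl → spread v })

      6ℚ : ℚ
      6ℚ = fromℕ 6

      -- Per recoloured node, the first-order loss counts 2 for each of the two endpoints and the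
      -- interaction inside the part counts 2, hence 6.
      cost-greedyStep : ∀ i c → R * 𝔼 samples (λ U → cost G (greedyStep i c U)) ≤ R * cost G c + 6ℚ * 𝔼 nodes (λ v → 𝟙 (inPart part i v))
      cost-greedyStep i c = begin
        R * 𝔼 samples (λ U → cost G (greedyStep i c U))
          ≤⟨ *-monoʳ (0≤fromℕ r) (𝔼-mono samples (λ U → cost-update i (λ v → choice G c v (r ℕ.* r) U) c)) ⟩
        R * 𝔼 samples (λ U → cost G c + (A U + A U) + 2ℚ * B)
          ≡⟨ cong (R *_) (trans (𝔼-+ samples (λ U → cost G c + (A U + A U)) (λ U → 2ℚ * B))
               (cong₂ _+_ (trans (𝔼-+ samples (λ U → cost G c) (λ U → A U + A U))
                  (cong₂ _+_ (𝔼-const samples (cost G c)) (𝔼-+ samples A A))) (𝔼-const samples (2ℚ * B)))) ⟩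
        R * (cost G c + (EA + EA) + 2ℚ * B)
          ≡⟨ solve 4 (λ R C A B → R :* (C :+ (A :+ A) :+ con 2ℚ :* B) := R :* C :+ con 2ℚ :* (R :* A) :+ con 2ℚ :* (R :* B)) refl R (cost G c) EA B ⟩
        R * cost G c + 2ℚ * (R * EA) + 2ℚ * (R * B)
          ≤⟨ ℚ.+-mono-≤ (ℚ.+-monoʳ-≤ (R * cost G c) (*-monoʳ (0≤fromℕ 2) RA)) (*-monoʳ (0≤fromℕ 2) RB) ⟩
        R * cost G c + 2ℚ * (μ * 2ℚ) + 2ℚ * μ
          ≡⟨ solve 2 (λ C μ → C :+ con 2ℚ :* (μ :* con 2ℚ) :+ con 2ℚ :* μ := C :+ con 6ℚ :* μ) refl (R * cost G c) μ ⟩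
        R * cost G c + 6ℚ * μ ∎
        where
        open ℚ.≤-Reasoning
        A : Vec (Fin N) (r ℕ.* r) → ℚ
        A U = 𝔼 nodes (λ v → 𝟙 (inPart part i v) * L c U v)
        B EA μ : ℚ
        B = 𝔼 nodes (λ v → 𝟙 (inPart part i v) * 𝔼 nodes (λ w → 𝟙 (inPart part i w) * weight (label G v w)))
        EA = 𝔼 samples A
        μ = 𝔼 nodes (λ v → 𝟙 (inPart part i v))
        RA : R * EA ≤ μ * 2ℚ
        RA = begin
          R * EA
            ≡⟨ cong (R *_) (𝔼-swap samples N (λ U v → 𝟙 (inPart part i v) * L c U v)) ⟩
          R * 𝔼 nodes (λ v → 𝔼 samples (λ U → 𝟙 (inPart part i v) * L c U v))
            ≡⟨ cong (R *_) (𝔼-cong nodes (λ v → 𝔼-*ˡ samples (𝟙 (inPart part i v)) (λ U → L c U v))) ⟩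
          R * 𝔼 nodes (λ v → 𝟙 (inPart part i v) * 𝔼 samples (λ U → L c U v))
            ≡⟨ 𝔼-*ˡ nodes R (λ v → 𝟙 (inPart part i v) * 𝔼 samples (λ U → L c U v)) ⟨
          𝔼 nodes (λ v → R * (𝟙 (inPart part i v) * 𝔼 samples (λ U → L c U v)))
            ≡⟨ 𝔼-cong nodes (λ v → solve 3 (λ R b x → R :* (b :* x) := b :* (R :* x)) refl R (𝟙 (inPart part i v)) (𝔼 samples (λ U → L c U v))) ⟩
          𝔼 nodes (λ v → 𝟙 (inPart part i v) * (R * 𝔼 samples (λ U → L c U v)))
            ≤⟨ 𝔼-mono nodes (λ v → *-monoʳ (0≤𝟙 (inPart part i v)) (𝔼-loss c v)) ⟩
          𝔼 nodes (λ v → 𝟙 (inPart part i v) * 2ℚ)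
            ≡⟨ 𝔼-*ʳ nodes 2ℚ (λ v → 𝟙 (inPart part i v)) ⟩
          μ * 2ℚ ∎
        RB : R * B ≤ μ
        RB = ℚ.≤-trans
          (ℚ.≤-reflexive (sym (𝔼-*ˡ nodes R (λ v → 𝟙 (inPart part i v) * 𝔼 nodes (λ w → 𝟙 (inPart part i w) * weight (label G v w))))))
          (𝔼-mono nodes (inside≤ i))

      from : ℕ → Fin N → ℚ
      from i v = 𝟙 (does (i ℕ.≤? part v))

      from-step : ∀ i v → 𝟙 (inPart part i v) + from (suc i) v ≤ from i v
      from-step i v = disjoint-≤ (part v ℕ.≟ i) (suc i ℕ.≤? part v) (i ℕ.≤? part v)
        (λ { refl i<p → ℕ.<-irrefl refl i<p }) (λ { refl → ℕ.≤-refl }) ℕ.<⇒≤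

      -- The nodes in parts from `i` on pay for the remaining steps. As parts are disjoint, these
      -- payments telescope rather than add up to a multiple of `l`.
      cost-hybrid : ∀ l i c → R * 𝔼 (iid samples l) (λ Us → cost G (final i c Us))
                    ≤ R * cost G c + 6ℚ * 𝔼 nodes (from i)
      cost-hybrid zero    i c = ≤-+ refl (0≤* (0≤fromℕ 6) (0≤𝔼 nodes (λ v → 0≤𝟙 (does (i ℕ.≤? part v)))))
      cost-hybrid (suc l) i c = begin
        -- `final i c (U ∷ Us)` unfolds to `final (suc i) (greedyStep i c U) Us`.
        R * 𝔼 samples (λ U → 𝔼 (iid samples l) (λ Us → cost G (final (suc i) (greedyStep i c U) Us)))
          ≡⟨ 𝔼-*ˡ samples R (λ U → 𝔼 (iid samples l) (λ Us → cost G (final (suc i) (greedyStep i c U) Us))) ⟨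
        𝔼 samples (λ U → R * 𝔼 (iid samples l) (λ Us → cost G (final (suc i) (greedyStep i c U) Us)))
          ≤⟨ 𝔼-mono samples (λ U → cost-hybrid l (suc i) (greedyStep i c U)) ⟩
        𝔼 samples (λ U → R * cost G (greedyStep i c U) + 6ℚ * 𝔼 nodes (from (suc i)))
          ≡⟨ trans (𝔼-+ samples (λ U → R * cost G (greedyStep i c U)) (λ _ → 6ℚ * 𝔼 nodes (from (suc i))))
               (cong₂ _+_ (𝔼-*ˡ samples R (λ U → cost G (greedyStep i c U))) (𝔼-const samples (6ℚ * 𝔼 nodes (from (suc i))))) ⟩
        R * 𝔼 samples (λ U → cost G (greedyStep i c U)) + 6ℚ * 𝔼 nodes (from (suc i))
          ≤⟨ ℚ.+-monoˡ-≤ (6ℚ * 𝔼 nodes (from (suc i))) (cost-greedyStep i c) ⟩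
        R * cost G c + 6ℚ * 𝔼 nodes (λ v → 𝟙 (inPart part i v)) + 6ℚ * 𝔼 nodes (from (suc i))
          ≡⟨ solve 3 (λ C a b → C :+ con 6ℚ :* a :+ con 6ℚ :* b := C :+ con 6ℚ :* (a :+ b)) refl (R * cost G c) (𝔼 nodes (λ v → 𝟙 (inPart part i v))) (𝔼 nodes (from (suc i))) ⟩
        R * cost G c + 6ℚ * (𝔼 nodes (λ v → 𝟙 (inPart part i v)) + 𝔼 nodes (from (suc i)))
          ≡⟨ cong (λ z → R * cost G c + 6ℚ * z) (𝔼-+ nodes (λ v → 𝟙 (inPart part i v)) (from (suc i))) ⟨
        R * cost G c + 6ℚ * 𝔼 nodes (λ v → 𝟙 (inPart part i v) + from (suc i) v)
          ≤⟨ ℚ.+-monoʳ-≤ (R * cost G c) (*-monoʳ (0≤fromℕ 6) (𝔼-mono nodes (from-step i))) ⟩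
        R * cost G c + 6ℚ * 𝔼 nodes (from i) ∎
        where open ℚ.≤-Reasoning

      cost-extend : (∀ v → part v ℕ.< r) → ∀ c →
        R * 𝔼 (iid samples r) (λ U → cost G (extend G U (hybrid 0 c U))) ≤ R * cost G c + 6ℚ
      cost-extend part<r c = begin
        R * 𝔼 (iid samples r) (λ U → cost G (extend G U (hybrid 0 c U)))
          ≡⟨ cong (R *_) (𝔼-cong (iid samples r) (λ U → 𝔼-cong nodes (λ v → 𝔼-cong nodes (λ w →
               cong₂ (λ a b → fromℕ (conflict (label G v w) a b)) (extend≡final U v) (extend≡final U w))))) ⟩
        R * 𝔼 (iid samples r) (λ U → cost G (final 0 c U))
          ≤⟨ cost-hybrid r 0 c ⟩
        R * cost G c + 6ℚ * 𝔼 nodes (from 0)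
          ≤⟨ ℚ.+-monoʳ-≤ (R * cost G c) (*-monoʳ (0≤fromℕ 6) (𝔼-mono nodes (λ v → 𝟙≤1 (does (0 ℕ.≤? part v))))) ⟩
        R * cost G c + 6ℚ * 𝔼 nodes (λ _ → 1ℚ)
          ≡⟨ cong (λ z → R * cost G c + 6ℚ * z) (𝔼-1 nodes) ⟩
        R * cost G c + 6ℚ * 1ℚ
          ≡⟨⟩
        R * cost G c + 6ℚ ∎
        where
        open ℚ.≤-Reasoning
        extend≡final : ∀ U v → extend G U (hybrid 0 c U) v ≡ final 0 c U v
        extend≡final U v = recolour-default v 0 (profile G U v) (hybrid 0 c U) v (c v) ℕ.z≤n (part<r v)

-- Edit distance

sumℕ-mono : ∀ {n} {f g : Fin n → ℕ} → (∀ i → f i ℕ.≤ g i) → Sumℕ.sum f ℕ.≤ Sumℕ.sum g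
sumℕ-mono {zero}  f≤g = ℕ.z≤n
sumℕ-mono {suc n} f≤g = ℕ.+-mono-≤ (f≤g zero) (sumℕ-mono (λ i → f≤g (suc i)))

doubleSum : ∀ {n} → (Fin n → Fin n → ℕ) → ℕ
doubleSum q = Sumℕ.sum λ v → Sumℕ.sum λ w → q v w

doubleSum-cong : ∀ {n} {p q : Fin n → Fin n → ℕ} → (∀ v w → p v w ≡ q v w) → doubleSum p ≡ doubleSum q
doubleSum-cong p≡q = Sumℕ.sum-cong-≗ (λ v → Sumℕ.sum-cong-≗ (p≡q v))

doubleSum-+ : ∀ {n} (p q : Fin n → Fin n → ℕ) → doubleSum (λ v w → p v w ℕ.+ q v w) ≡ doubleSum p ℕ.+ doubleSum q
doubleSum-+ p q = trans (Sumℕ.sum-cong-≗ (λ v → Sumℕ.∑-distrib-+ (p v) (q v)))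
  (Sumℕ.∑-distrib-+ (λ v → Sumℕ.sum (p v)) (λ v → Sumℕ.sum (q v)))

above : ∀ {n} → (Fin n → Fin n → ℕ) → Fin n → Fin n → ℕ
above q v w = if does (v Fin.<? w) then q v w else 0

doubleSum-above : ∀ {n} (q : Fin n → Fin n → ℕ) → (∀ v w → q v w ≡ q w v) → (∀ v → q v v ≡ 0) →
                  doubleSum q ≡ doubleSum (above q) ℕ.+ doubleSum (above q)
doubleSum-above q q-sym q-diag = trans (doubleSum-cong pointwise)
  (trans (doubleSum-+ (above q) (λ v w → above q w v))
    (cong (doubleSum (above q) ℕ.+_) (Sumℕ.∑-comm (λ v w → above q w v))))
  where
  pointwise : ∀ v w → q v w ≡ above q v w ℕ.+ above q w v
  pointwise v w with Fin.<-cmp v w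
  ... | tri< v<w _ w≮v rewrite dec-true (v Fin.<? w) v<w | dec-false (w Fin.<? v) w≮v = sym (ℕ.+-identityʳ (q v w))
  ... | tri> v≮w _ w<v rewrite dec-false (v Fin.<? w) v≮w | dec-true (w Fin.<? v) w<v = q-sym v w
  ... | tri≈ v≮v refl _ rewrite dec-false (v Fin.<? v) v≮v = q-diag v

module _ {N : ℕ} where

  differ : SignedGraph N → SignedGraph N → Fin N → Fin N → ℕ
  differ G H v w = if does (label G v w ≟ˡ label H v w) then 0 else 1

  doubleSum-differ : ∀ G H → doubleSum (differ G H) ≡ modifications G H ℕ.+ modifications G H
  doubleSum-differ G H = trans (doubleSum-above (differ G H) differ-sym differ-diag) (cong₂ ℕ._+_ above≡ above≡)
    where
    differ-sym : ∀ v w → differ G H v w ≡ differ G H w v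
    differ-sym v w rewrite symmetric G v w | symmetric H v w = refl
    differ-diag : ∀ v → differ G H v v ≡ 0
    differ-diag v rewrite irreflexive G v | irreflexive H v = refl
    ∧-not : ∀ a b → (if a then (if b then 0 else 1) else 0) ≡ (if a ∧ not b then 1 else 0)
    ∧-not false b     = refl
    ∧-not true  false = refl
    ∧-not true  true  = refl
    above≡ : doubleSum (above (differ G H)) ≡ modifications G H
    above≡ = doubleSum-cong (λ v w → ∧-not (does (v Fin.<? w)) (does (label G v w ≟ˡ label H v w)))

conflict≤1 : ∀ {n} l (a b : Fin n) → conflict l a b ℕ.≤ 1
conflict≤1 nothing       a b = ℕ.z≤n
conflict≤1 (just Sign.+) a b with a Fin.≟ b
... | yes _ = ℕ.z≤n
... | no _  = ℕ.≤-refl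
conflict≤1 (just Sign.-) a b with a Fin.≟ b
... | yes _ = ℕ.≤-refl
... | no _  = ℕ.z≤n

-- Deleting exactly the violated edges repairs the graph for a given colouring, at one modification
-- per violated edge.
erase : ∀ {n} → Maybe Sign → Fin n → Fin n → Maybe Sign
erase nothing       a b = nothing
erase (just Sign.+) a b = if does (a Fin.≟ b) then just Sign.+ else nothing
erase (just Sign.-) a b = if does (a Fin.≟ b) then nothing else just Sign.-

erase-+ : ∀ {n} l (a b : Fin n) → erase l a b ≡ just Sign.+ → a ≡ b
erase-+ (just Sign.+) a b e≡ with a Fin.≟ b
... | yes a≡b = a≡b
erase-+ (just Sign.-) a b e≡ with a Fin.≟ b
erase-+ (just Sign.-) a b () | yes _
erase-+ (just Sign.-) a b () | no _

erase-- : ∀ {n} l (a b : Fin n) → erase l a b ≡ just Sign.- → a ≢ b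
erase-- (just Sign.-) a b e≡ with a Fin.≟ b
... | no a≢b = a≢b
erase-- (just Sign.+) a b e≡ with a Fin.≟ b
erase-- (just Sign.+) a b () | yes _
erase-- (just Sign.+) a b () | no _

erase-comm : ∀ {n} l (a b : Fin n) → erase l a b ≡ erase l b a
erase-comm nothing       a b = refl
erase-comm (just Sign.+) a b with a Fin.≟ b | b Fin.≟ a
... | yes _   | yes _   = refl
... | no _    | no _    = refl
... | yes a≡b | no b≢a  = contradiction (sym a≡b) b≢a
... | no a≢b  | yes b≡a = contradiction (sym b≡a) a≢b
erase-comm (just Sign.-) a b with a Fin.≟ b | b Fin.≟ a
... | yes _   | yes _   = refl
... | no _    | no _    = refl
... | yes a≡b | no b≢a  = contradiction (sym a≡b) b≢a
... | no a≢b  | yes b≡a = contradiction (sym b≡a) a≢b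

erase-conflict : ∀ {n} l (a b : Fin n) → conflict l a b ≡ (if does (l ≟ˡ erase l a b) then 0 else 1)
erase-conflict nothing       a b = refl
erase-conflict (just Sign.+) a b with a Fin.≟ b
... | yes _ = refl
... | no _  = refl
erase-conflict (just Sign.-) a b with a Fin.≟ b
... | yes _ = refl
... | no _  = refl

module _ {N : ℕ} .{{_ : NonZero N}} (G : SignedGraph N) where
  private
    N² : ℚ
    N² = fromℕ (N ℕ.* N)

  cost-doubleSum : ∀ c → N² * cost G c ≡ fromℕ (doubleSum (λ v w → conflict (label G v w) (c v) (c w)))
  cost-doubleSum c = begin
    N² * cost G c
      ≡⟨ cong (_* cost G c) (fromℕ-* N N) ⟩
    fromℕ N * fromℕ N * cost G c
      ≡⟨ ℚ.*-assoc (fromℕ N) (fromℕ N) (cost G c) ⟩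
    fromℕ N * (fromℕ N * cost G c)
      ≡⟨ cong (fromℕ N *_) (average-* N (λ v → average N (λ w → C v w))) ⟩
    fromℕ N * Sumℚ.sum (λ v → average N (C v))
      ≡⟨ SumRing.*-distribˡ-sum (fromℕ N) (λ v → average N (C v)) ⟩
    Sumℚ.sum (λ v → fromℕ N * average N (C v))
      ≡⟨ Sumℚ.sum-cong-≗ (λ v → trans (average-* N (C v)) (sym (fromℕ-sum (λ w → conflict (label G v w) (c v) (c w))))) ⟩
    Sumℚ.sum (λ v → fromℕ (Sumℕ.sum (λ w → conflict (label G v w) (c v) (c w))))
      ≡⟨ fromℕ-sum (λ v → Sumℕ.sum (λ w → conflict (label G v w) (c v) (c w))) ⟨
    fromℕ (doubleSum (λ v w → conflict (label G v w) (c v) (c w))) ∎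
    where
    open ≡-Reasoning
    C : Fin N → Fin N → ℚ
    C v w = fromℕ (conflict (label G v w) (c v) (c w))

  cost≤1 : ∀ c → cost G c ≤ 1ℚ
  cost≤1 c = ℚ.≤-trans
    (𝔼-mono (uniform N) (λ v → 𝔼-mono (uniform N) (λ w → fromℕ-mono {conflict (label G v w) (c v) (c w)} {1} (conflict≤1 (label G v w) (c v) (c w)))))
    (ℚ.≤-reflexive (trans (𝔼-cong (uniform N) (λ _ → 𝔼-1 (uniform N))) (𝔼-1 (uniform N))))

  private
    instance
      N*N≢0 : NonZero (N ℕ.* N)
      N*N≢0 = ℕ.m*n≢0 N N

    0<N² : 0ℚ < N²
    0<N² = fromℕ-pos (N ℕ.* N)

    twice : ∀ n → fromℕ (n ℕ.+ n) ≡ 2ℚ * fromℕ n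
    twice n = trans (fromℕ-+ n n) (solve 1 (λ n → n :+ n := con 2ℚ :* n) refl (fromℕ n))

  eraseConflicts : (Fin N → Fin N) → SignedGraph N
  eraseConflicts c = record
    { label       = λ v w → erase (label G v w) (c v) (c w)
    ; symmetric   = λ v w → trans (cong (λ l → erase l (c v) (c w)) (symmetric G v w)) (erase-comm (label G w v) (c v) (c w))
    ; irreflexive = λ v → cong (λ l → erase l (c v) (c v)) (irreflexive G v)
    }

  eraseConflicts-clusterable : ∀ c → Clusterable (eraseConflicts c)
  eraseConflicts-clusterable c = N , c ,
    (λ v w → erase-+ (label G v w) (c v) (c w)) , (λ v w → erase-- (label G v w) (c v) (c w))

  -- The graph without the conflicts of `c` is clusterable, so farness bounds their number from
  -- below; ordered pairs account for the factor 2.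
  far⇒cost≥ : ∀ {ε} → Far ε Clusterable G → ∀ c → 2ℚ * ε ≤ cost G c
  far⇒cost≥ {ε} far c = cancelˡ 0<N² (begin
    N² * (2ℚ * ε)                                  ≡⟨ solve 2 (λ n e → n :* (con 2ℚ :* e) := con 2ℚ :* (e :* n)) refl N² ε ⟩
    2ℚ * (ε * N²)                                  ≤⟨ *-monoʳ (0≤fromℕ 2) (far H (eraseConflicts-clusterable c)) ⟩
    2ℚ * fromℕ (modifications G H)                 ≡⟨ twice (modifications G H) ⟨
    fromℕ (modifications G H ℕ.+ modifications G H) ≡⟨ cong fromℕ (doubleSum-differ G H) ⟨
    fromℕ (doubleSum (differ G H))                 ≡⟨ cong fromℕ (doubleSum-cong (λ v w → erase-conflict (label G v w) (c v) (c w))) ⟨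
    fromℕ (doubleSum (λ v w → conflict (label G v w) (c v) (c w))) ≡⟨ cost-doubleSum c ⟨
    N² * cost G c                                  ∎)
    where
    open ℚ.≤-Reasoning
    H = eraseConflicts c

-- Only the kernel of a clustering matters, so its classes can be named by their members.

module _ {N k : ℕ} (c : Fin N → Fin k) where

  member : Fin N → Fin k → Fin N
  member v a with Fin.any? (λ w → c w Fin.≟ a)
  ... | yes (w , _) = w
  -- Out of reach when `a` is `c v`, since then `v` itself is found.
  ... | no _        = v

  class : Fin N → Fin N
  class v = member v (c v)

  class-cong : ∀ {v w} → c v ≡ c w → class v ≡ class w
  class-cong {v} {w} cv≡cw rewrite cv≡cw with Fin.any? (λ u → c u Fin.≟ c w)
  ... | yes _ = refl
  ... | no ∄w = contradiction (w , refl) ∄w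

  class-injective : ∀ {v w} → class v ≡ class w → c v ≡ c w
  class-injective {v} {w} e≡ = trans (sym (c-class v)) (trans (cong c e≡) (c-class w))
    where
    c-class : ∀ v → c (class v) ≡ c v
    c-class v with Fin.any? (λ w → c w Fin.≟ c v)
    ... | yes (_ , cw≡cv) = cw≡cv
    ... | no ∄w           = refl

conflict-≡ : ∀ {n} l {a b : Fin n} → (l ≡ just Sign.+ → a ≡ b) → (l ≡ just Sign.- → a ≢ b) → conflict l a b ≡ 0
conflict-≡ nothing       {a} {b} pos neg = refl
conflict-≡ (just Sign.+) {a} {b} pos neg with a Fin.≟ b
... | yes _  = refl
... | no a≢b = contradiction (pos refl) a≢b
conflict-≡ (just Sign.-) {a} {b} pos neg with a Fin.≟ b
... | yes a≡b = contradiction a≡b (neg refl)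
... | no _    = refl

module _ {N : ℕ} .{{_ : NonZero N}} {G : SignedGraph N} where

  -- A clustering of a nearby `H` can violate a pair of `G` only where the two graphs differ: at
  -- most `ε / 4 · N²` edges, or `ε / 2 · N²` ordered pairs.
  close⇒cost≤ : ∀ {ε} → Close (ε * (ℤ.+ 1 / 4)) Clusterable G → ∃ λ c → 2ℚ * cost G c ≤ ε
  close⇒cost≤ {ε} (H , (k , c₀ , pos , neg) , mod≤) = c , cancelˡ (fromℕ-pos (N ℕ.* N) {{ℕ.m*n≢0 N N}}) (begin
    N² * (2ℚ * cost G c)                                ≡⟨ solve 2 (λ n x → n :* (con 2ℚ :* x) := con 2ℚ :* (n :* x)) refl N² (cost G c) ⟩
    2ℚ * (N² * cost G c)                                ≡⟨ cong (2ℚ *_) (cost-doubleSum G c) ⟩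
    2ℚ * fromℕ conflicts                                ≤⟨ *-monoʳ (0≤fromℕ 2) (fromℕ-mono {conflicts} {doubleSum (differ G H)} (sumℕ-mono (λ v → sumℕ-mono (conflict≤differ v)))) ⟩
    2ℚ * fromℕ (doubleSum (differ G H))                 ≡⟨ cong (λ n → 2ℚ * fromℕ n) (doubleSum-differ G H) ⟩
    2ℚ * fromℕ (mods ℕ.+ mods)                          ≡⟨ cong (2ℚ *_) (fromℕ-+ mods mods) ⟩
    2ℚ * (fromℕ mods + fromℕ mods)                      ≤⟨ *-monoʳ (0≤fromℕ 2) (ℚ.+-mono-≤ mod≤ mod≤) ⟩
    2ℚ * (ε * (ℤ.+ 1 / 4) * N² + ε * (ℤ.+ 1 / 4) * N²)  ≡⟨ solve 2 (λ e n → con 2ℚ :* (e :* con (ℤ.+ 1 / 4) :* n :+ e :* con (ℤ.+ 1 / 4) :* n) := n :* e) refl ε N² ⟩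
    N² * ε                                              ∎)
    where
    open ℚ.≤-Reasoning
    N² = fromℕ (N ℕ.* N)
    mods = modifications G H
    c : Fin N → Fin N
    c = class c₀
    conflicts = doubleSum (λ v w → conflict (label G v w) (c v) (c w))
    conflict≤differ : ∀ v w → conflict (label G v w) (c v) (c w) ℕ.≤ differ G H v w
    conflict≤differ v w with label G v w ≟ˡ label H v w
    ... | no _    = conflict≤1 (label G v w) (c v) (c w)
    ... | yes G≡H = ℕ.≤-reflexive (conflict-≡ (label G v w)
      (λ + → class-cong c₀ (pos v w (trans (sym G≡H) +)))
      (λ - e≡ → neg v w (trans (sym G≡H) -) (class-injective c₀ e≡)))

-- Splitting the nodes into intervals

-- Removing the first index shifts the interval down while `a` is positive and shortens it
-- afterwards.
count-interval : ∀ n a s (f : Fin n → Bool) → (∀ i → f i ≡ true → a ℕ.≤ toℕ i × toℕ i ℕ.< a ℕ.+ s) →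
                 Sumℚ.sum (λ i → 𝟙 (f i)) ≤ fromℕ s
count-interval zero    a       s       f f⊆ = 0≤fromℕ s
count-interval (suc n) (suc a) s       f f⊆ with f zero in e≡
... | true  with () ← proj₁ (f⊆ zero e≡)
... | false = subst (_≤ fromℕ s) (sym (ℚ.+-identityˡ _))
  (count-interval n a s (λ i → f (suc i)) (λ i fi → ℕ.≤-pred (proj₁ (f⊆ (suc i) fi)) , ℕ.≤-pred (proj₂ (f⊆ (suc i) fi))))
count-interval (suc n) zero    zero    f f⊆ with f zero in e≡
... | true  with () ← proj₂ (f⊆ zero e≡)
... | false = subst (_≤ 0ℚ) (sym (ℚ.+-identityˡ _))
  (count-interval n 0 0 (λ i → f (suc i)) (λ i fi → contradiction (proj₂ (f⊆ (suc i) fi)) ℕ.n≮0))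
count-interval (suc n) zero    (suc s) f f⊆ = subst (Sumℚ.sum (λ i → 𝟙 (f i)) ≤_) (sym (fromℕ-suc s))
  (ℚ.+-mono-≤ (𝟙≤1 (f zero))
    (count-interval n 0 s (λ i → f (suc i)) (λ i fi → ℕ.z≤n , ℕ.≤-pred (proj₂ (f⊆ (suc i) fi)))))

m<[1+m/n]*n : ∀ m n .{{_ : NonZero n}} → m ℕ.< suc (m ℕ./ n) ℕ.* n
m<[1+m/n]*n m n = ℕ.<-≤-trans (ℕ.≤-<-trans (ℕ.≤-reflexive (ℕ.m≡m%n+[m/n]*n m n))
  (ℕ.+-monoˡ-< (m ℕ./ n ℕ.* n) (ℕ.m%n<n m n))) ℕ.≤-refl

module _ {N : ℕ} .{{_ : NonZero N}} (r : ℕ) .{{_ : NonZero r}} where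

  -- Rounded up, so that `r` parts cover all nodes.
  partSize : ℕ
  partSize = suc (N ℕ./ r)

  interval : Fin N → ℕ
  interval v = toℕ v ℕ./ partSize

  interval<r : ∀ v → interval v ℕ.< r
  interval<r v = ℕ.*-cancelʳ-< partSize (interval v) r (begin-strict
    interval v ℕ.* partSize  ≤⟨ ℕ.m/n*n≤m (toℕ v) partSize ⟩
    toℕ v                    <⟨ Fin.toℕ<n v ⟩
    N                        <⟨ m<[1+m/n]*n N r ⟩
    partSize ℕ.* r           ≡⟨ ℕ.*-comm partSize r ⟩
    r ℕ.* partSize           ∎)
    where open ℕ.≤-Reasoning

  count-part : ∀ i → Sumℚ.sum (λ w → 𝟙 (does (interval w ℕ.≟ i))) ≤ fromℕ partSize
  count-part i = count-interval N (i ℕ.* partSize) partSize (λ w → does (interval w ℕ.≟ i)) λ w w∈i →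
    bounds w (invert (interval w ℕ.≟ i) w∈i)
    where
    invert : ∀ {P : Set} (P? : Dec P) → does P? ≡ true → P
    invert (yes p) _ = p
    bounds : ∀ w → interval w ≡ i → i ℕ.* partSize ℕ.≤ toℕ w × toℕ w ℕ.< i ℕ.* partSize ℕ.+ partSize
    bounds w refl = ℕ.m/n*n≤m (toℕ w) partSize ,
      ℕ.<-≤-trans (m<[1+m/n]*n (toℕ w) partSize) (ℕ.≤-reflexive (ℕ.+-comm partSize (interval w ℕ.* partSize)))

  -- A part may have `N / r + 1` nodes, but `v` is not adjacent to itself. At most `N / r`
  -- neighbours remain, and no rounding error enters the bound.
  interval-spread : ∀ (G : SignedGraph N) v →
    fromℕ r * 𝔼 (uniform N) (λ w → 𝟙 (inPart interval (interval v) w) * weight (label G v w)) ≤ 1ℚ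
  interval-spread G v = cancelˡ (fromℕ-pos N) (begin
    fromℕ N * (fromℕ r * average N f)    ≡⟨ solve 3 (λ n r a → n :* (r :* a) := r :* (n :* a)) refl (fromℕ N) (fromℕ r) (average N f) ⟩
    fromℕ r * (fromℕ N * average N f)    ≡⟨ cong (fromℕ r *_) (average-* N f) ⟩
    fromℕ r * Sumℚ.sum f                 ≤⟨ *-monoʳ (0≤fromℕ r) sum≤ ⟩
    fromℕ r * fromℕ (N ℕ./ r)            ≡⟨ fromℕ-* r (N ℕ./ r) ⟨
    fromℕ (r ℕ.* (N ℕ./ r))              ≤⟨ fromℕ-mono {r ℕ.* (N ℕ./ r)} {N} (ℕ.≤-trans (ℕ.≤-reflexive (ℕ.*-comm r (N ℕ./ r))) (ℕ.m/n*n≤m N r)) ⟩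
    fromℕ N                              ≡⟨ ℚ.*-identityʳ (fromℕ N) ⟨
    fromℕ N * 1ℚ                         ∎)
    where
    open ℚ.≤-Reasoning
    f : Fin N → ℚ
    f w = 𝟙 (inPart interval (interval v) w) * weight (label G v w)

    -- v itself lies in its part but carries no weight.
    pointwise : ∀ w → eq v w + f w ≤ 𝟙 (inPart interval (interval v) w)
    pointwise w with v Fin.≟ w
    ... | yes refl = self (interval v ℕ.≟ interval v)
      where
      self : (P? : Dec (interval v ≡ interval v)) → 1ℚ + 𝟙 (does P?) * weight (label G v v) ≤ 𝟙 (does P?)
      self (yes _) = ℚ.≤-reflexive (cong (λ l → 1ℚ + 1ℚ * weight l) (irreflexive G v))
      self (no ≢)  = contradiction refl ≢
    ... | no _ = subst (_≤ 𝟙 b) (sym (ℚ.+-identityˡ (𝟙 b * weight (label G v w))))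
      (subst (𝟙 b * weight (label G v w) ≤_) (ℚ.*-identityʳ (𝟙 b)) (*-monoʳ (0≤𝟙 b) (weight≤1 (label G v w))))
      where b = inPart interval (interval v) w

    sum≤ : Sumℚ.sum f ≤ fromℕ (N ℕ./ r)
    sum≤ = +-cancelˡ 1ℚ (begin
      1ℚ + Sumℚ.sum f                        ≡⟨ cong (_+ Sumℚ.sum f) (sum-eq v) ⟨
      Sumℚ.sum (eq v) + Sumℚ.sum f           ≡⟨ Sumℚ.∑-distrib-+ (eq v) f ⟨
      Sumℚ.sum (λ w → eq v w + f w)          ≤⟨ sum-mono pointwise ⟩
      Sumℚ.sum (λ w → 𝟙 (inPart interval (interval v) w)) ≤⟨ count-part (interval v) ⟩
      fromℕ partSize                         ≡⟨ fromℕ-suc (N ℕ./ r) ⟩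
      1ℚ + fromℕ (N ℕ./ r)                   ∎)

-- Choice of the parameters

-- Recursion along `n ↦ ⌈n/2⌉`, which lowers the logarithm by one.
n≤2^⌈log₂n⌉ : ∀ n → n ℕ.≤ 2 ℕ.^ ⌈log₂ n ⌉
n≤2^⌈log₂n⌉ n = go n (<-wellFounded n)
  where
  go : ∀ n → Acc ℕ._<_ n → n ℕ.≤ 2 ℕ.^ ⌈log₂ n ⌉
  go 0 _ = ℕ.z≤n
  go 1 _ = ℕ.≤-refl
  go n@(suc (suc n-2)) (acc rec) = begin
    n                                        ≡⟨ ℕ.⌊n/2⌋+⌈n/2⌉≡n n ⟨
    ℕ.⌊ n /2⌋ ℕ.+ ℕ.⌈ n /2⌉                  ≤⟨ ℕ.+-mono-≤ (ℕ.⌊n/2⌋≤⌈n/2⌉ n) ℕ.≤-refl ⟩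
    ℕ.⌈ n /2⌉ ℕ.+ ℕ.⌈ n /2⌉                  ≤⟨ ℕ.+-mono-≤ ih ih ⟩
    h ℕ.+ h                                  ≡⟨ cong (h ℕ.+_) (ℕ.+-identityʳ h) ⟨
    2 ℕ.^ suc ⌈log₂ ℕ.⌈ n /2⌉ ⌉              ≡⟨ cong (λ l → 2 ℕ.^ suc l) (⌈log₂⌈n/2⌉⌉≡⌈log₂n⌉∸1 n) ⟩
    2 ℕ.^ suc (⌈log₂ n ⌉ ℕ.∸ 1)              ≡⟨ cong (2 ℕ.^_) (ℕ.m+[n∸m]≡n {1} {⌈log₂ n ⌉} (⌈log₂⌉-mono-≤ {2} {n} (ℕ.s≤s (ℕ.s≤s ℕ.z≤n)))) ⟩
    2 ℕ.^ ⌈log₂ n ⌉                          ∎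
    where
    open ℕ.≤-Reasoning
    h = 2 ℕ.^ ⌈log₂ ℕ.⌈ n /2⌉ ⌉
    ih : ℕ.⌈ n /2⌉ ℕ.≤ h
    ih = go ℕ.⌈ n /2⌉ (rec (ℕ.⌈n/2⌉<n n-2))

fromℕ-^ : ∀ a n → fromℕ (a ℕ.^ n) ≡ fromℕ a ^ n
fromℕ-^ a zero    = refl
fromℕ-^ a (suc n) = trans (fromℕ-* a (a ℕ.^ n)) (cong (fromℕ a *_) (fromℕ-^ a n))

1^n : ∀ n → 1ℚ ^ n ≡ 1ℚ
1^n zero    = refl
1^n (suc n) = trans (ℚ.*-identityˡ (1ℚ ^ n)) (1^n n)

numerator : ∀ a d .(c : Coprime a (suc d)) → mkℚ (ℤ.+ a) d c * fromℕ (suc d) ≡ fromℕ a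
numerator a d c = ℚ.toℚᵘ-injective (begin
  toℚᵘ (mkℚ (ℤ.+ a) d c * fromℕ (suc d))           ≈⟨ ℚ.toℚᵘ-homo-* (mkℚ (ℤ.+ a) d c) (fromℕ (suc d)) ⟩
  ℚᵘ.mkℚᵘ (ℤ.+ a) d ℚᵘ.* toℚᵘ (fromℕ (suc d))      ≈⟨ ℚᵘ.*-cong (ℚᵘ.≃-refl {ℚᵘ.mkℚᵘ (ℤ.+ a) d}) (fromℕᵘ (suc d)) ⟩
  ℚᵘ.mkℚᵘ (ℤ.+ a) d ℚᵘ.* ℚᵘ.mkℚᵘ (ℤ.+ suc d) 0     ≈⟨ ℚᵘ.*≡* (ℤ.*-assoc (ℤ.+ a) (ℤ.+ suc d) (ℤ.+ 1)) ⟩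
  ℚᵘ.mkℚᵘ (ℤ.+ a) 0                                ≈⟨ fromℕᵘ a ⟨
  toℚᵘ (fromℕ a)                                   ∎)
  where open ℚᵘ.≃-Reasoning

-- For `ε = a / D` the value `⌊100 D / a⌋ + 1` exceeds `100 / ε` by at most one, and one more costs
-- at most 1 in the product because `ε ≤ 1`.
scale : ∀ ε → .{{Positive ε}} → ε ≤ 1ℚ → ∃ λ s → fromℕ 100 ≤ fromℕ (suc s) * ε × fromℕ (suc s) * ε ≤ fromℕ 101
scale ε@(mkℚ ℤ.+[1+ a-1 ] d c) ε≤1 = s , cancelˡ 0<D lower , upper
  where
  open ℚ.≤-Reasoning
  a D s : ℕ
  a = suc a-1
  D = suc d
  s = (100 ℕ.* D) ℕ./ a
  0<D : 0ℚ < fromℕ D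
  0<D = fromℕ-pos D
  *ε : ∀ n → fromℕ D * (fromℕ n * ε) ≡ fromℕ (n ℕ.* a)
  *ε n = begin-equality
    fromℕ D * (fromℕ n * ε)   ≡⟨ solve 3 (λ d n e → d :* (n :* e) := n :* (e :* d)) refl (fromℕ D) (fromℕ n) ε ⟩
    fromℕ n * (ε * fromℕ D)   ≡⟨ cong (fromℕ n *_) (numerator a d c) ⟩
    fromℕ n * fromℕ a         ≡⟨ fromℕ-* n a ⟨
    fromℕ (n ℕ.* a)           ∎
  lower : fromℕ D * fromℕ 100 ≤ fromℕ D * (fromℕ (suc s) * ε)
  lower = begin
    fromℕ D * fromℕ 100              ≡⟨ trans (ℚ.*-comm (fromℕ D) (fromℕ 100)) (sym (fromℕ-* 100 D)) ⟩
    fromℕ (100 ℕ.* D)                ≤⟨ fromℕ-mono {100 ℕ.* D} {suc s ℕ.* a} (ℕ.<⇒≤ (m<[1+m/n]*n (100 ℕ.* D) a)) ⟩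
    fromℕ (suc s ℕ.* a)              ≡⟨ *ε (suc s) ⟨
    fromℕ D * (fromℕ (suc s) * ε)    ∎
  sε≤100 : fromℕ s * ε ≤ fromℕ 100
  sε≤100 = cancelˡ 0<D (begin
    fromℕ D * (fromℕ s * ε)          ≡⟨ *ε s ⟩
    fromℕ (s ℕ.* a)                  ≤⟨ fromℕ-mono {s ℕ.* a} {100 ℕ.* D} (ℕ.m/n*n≤m (100 ℕ.* D) a) ⟩
    fromℕ (100 ℕ.* D)                ≡⟨ trans (fromℕ-* 100 D) (ℚ.*-comm (fromℕ 100) (fromℕ D)) ⟩
    fromℕ D * fromℕ 100              ∎)
  upper : fromℕ (suc s) * ε ≤ fromℕ 101
  upper = begin
    fromℕ (suc s) * ε       ≡⟨ cong (_* ε) (fromℕ-suc s) ⟩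
    (1ℚ + fromℕ s) * ε      ≡⟨ solve 2 (λ s e → (con 1ℚ :+ s) :* e := e :+ s :* e) refl (fromℕ s) ε ⟩
    ε + fromℕ s * ε         ≤⟨ ℚ.+-mono-≤ ε≤1 sε≤100 ⟩
    1ℚ + fromℕ 100          ≡⟨⟩
    fromℕ 101               ∎

2/3≤ : ∀ {P} → 1ℚ - P ≤ ℤ.+ 1 / 3 → ℤ.+ 2 / 3 ≤ P
2/3≤ {P} y≤1/3 = ≤-+ (solve 1 (λ P → P := con (ℤ.+ 2 / 3) :+ (con (ℤ.+ 1 / 3) :- (con 1ℚ :- P))) refl P) (≤⇒0≤- y≤1/3)

-- The expected count is at most `(101 / 2 + 6) j`, that is `113 j / 2`, against the threshold
-- `170 j`; and `113 / 340 < 1 / 3`.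
accept-bound : ∀ {R E C ε y} j → 0ℚ < j → fromℕ 170 * j * y ≤ R * j * E → R * E ≤ R * C + fromℕ 6 →
               2ℚ * C ≤ ε → 0ℚ ≤ R → R * ε ≤ fromℕ 101 → y ≤ ℤ.+ 1 / 3
accept-bound {R} {E} {C} {ε} {y} j 0<j Ty≤mE RE≤ 2C≤ε 0≤R Rε≤ =
  cancelˡ {r = fromℕ 340 * j} (0<* (fromℕ-pos 340) 0<j) (begin
    fromℕ 340 * j * y               ≡⟨ solve 2 (λ j y → con (fromℕ 340) :* j :* y := con 2ℚ :* (con (fromℕ 170) :* j :* y)) refl j y ⟩
    2ℚ * (fromℕ 170 * j * y)        ≤⟨ *-monoʳ (0≤fromℕ 2) Ty≤mE ⟩
    2ℚ * (R * j * E)                ≡⟨ solve 3 (λ R j E → con 2ℚ :* (R :* j :* E) := con 2ℚ :* j :* (R :* E)) refl R j E ⟩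
    2ℚ * j * (R * E)                ≤⟨ *-monoʳ (0≤* (0≤fromℕ 2) (ℚ.<⇒≤ 0<j)) RE≤ ⟩
    2ℚ * j * (R * C + fromℕ 6)      ≡⟨ solve 3 (λ R j C → con 2ℚ :* j :* (R :* C :+ con (fromℕ 6)) := j :* (R :* (con 2ℚ :* C) :+ con (fromℕ 12))) refl R j C ⟩
    j * (R * (2ℚ * C) + fromℕ 12)   ≤⟨ *-monoʳ (ℚ.<⇒≤ 0<j) (ℚ.+-monoˡ-≤ (fromℕ 12) (ℚ.≤-trans (*-monoʳ 0≤R 2C≤ε) Rε≤)) ⟩
    j * (fromℕ 101 + fromℕ 12)      ≤⟨ *-monoʳ (ℚ.<⇒≤ 0<j) (ℚ.≤ᵇ⇒≤ _) ⟩
    j * (fromℕ 340 * (ℤ.+ 1 / 3))   ≡⟨ solve 1 (λ j → j :* (con (fromℕ 340) :* con (ℤ.+ 1 / 3)) := con (fromℕ 340) :* j :* con (ℤ.+ 1 / 3)) refl j ⟩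
    fromℕ 340 * j * (ℤ.+ 1 / 3)     ∎)
  where open ℚ.≤-Reasoning

-- With r ε ≥ 100 and β = 1 - h, increasing j by one multiplies β ^ (170 j) by at
-- least 183/200 and (1 - 2hε) ^ (r j) by at most 10/11, so their ratio grows by a
-- factor of at least 1 + 13/2000, which doubles in 160 steps.
11/10 : ℚ
11/10 = ℤ.+ 11 / 10

h : ℚ
h = ℤ.+ 1 / 2000

^-growth : ∀ {q} y n → 0ℚ ≤ 1ℚ + y → 1ℚ + y ≤ q → 1ℚ + fromℕ n * y ≤ q ^ n
^-growth y n 0≤1+y 1+y≤q = ℚ.≤-trans (bernoulli 0≤1+y n) (^-monoˡ 0≤1+y 1+y≤q n)

-- `bernoulli⁻¹` with `r x ≥ h · 2 · 100 = 1 / 10`.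
decay : ∀ {ε} r → 0ℚ ≤ ε → ε ≤ 1ℚ → fromℕ 100 ≤ fromℕ r * ε →
        0ℚ ≤ 1ℚ - h * (2ℚ * ε) × (1ℚ - h * (2ℚ * ε)) ^ r * 11/10 ≤ 1ℚ
decay {ε} r 0≤ε ε≤1 100≤ = 0≤1-x , (begin
    u * 11/10                ≤⟨ *-monoʳ (0≤^ 0≤1-x r) 11/10≤ ⟩
    u * (1ℚ + fromℕ r * x)   ≤⟨ bernoulli⁻¹ 0≤1-x 0≤x r ⟩
    1ℚ                       ∎)
  where
  open ℚ.≤-Reasoning
  x u : ℚ
  x = h * (2ℚ * ε)
  u = (1ℚ - x) ^ r
  0≤x : 0ℚ ≤ x
  0≤x = 0≤* {h} (ℚ.≤ᵇ⇒≤ _) (0≤* (0≤fromℕ 2) 0≤ε)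
  0≤1-x : 0ℚ ≤ 1ℚ - x
  0≤1-x = ≤⇒0≤- (ℚ.≤-trans (*-monoʳ {h} (ℚ.≤ᵇ⇒≤ _) (*-monoʳ (0≤fromℕ 2) ε≤1)) (ℚ.≤ᵇ⇒≤ {h * (2ℚ * 1ℚ)} {1ℚ} _))
  11/10≤ : 11/10 ≤ 1ℚ + fromℕ r * x
  11/10≤ = begin
    11/10                                  ≡⟨⟩
    1ℚ + h * 2ℚ * fromℕ 100                ≤⟨ ℚ.+-monoʳ-≤ 1ℚ (*-monoʳ {h * 2ℚ} (ℚ.≤ᵇ⇒≤ _) 100≤) ⟩
    1ℚ + h * 2ℚ * (fromℕ r * ε)            ≡⟨ cong (1ℚ +_) (solve 3 (λ h r e → h :* con 2ℚ :* (r :* e) := r :* (h :* (con 2ℚ :* e))) refl h (fromℕ r) ε) ⟩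
    1ℚ + fromℕ r * x                       ∎

growth : ∀ {β} → 1ℚ - h ≤ β → 2ℚ ≤ (β ^ 170 * 11/10) ^ 160
growth {β} 1-h≤β = ℚ.≤-trans (ℚ.≤ᵇ⇒≤ {2ℚ} {1ℚ + fromℕ 160 * (ℤ.+ 13 / 2000)} _)
  (^-growth (ℤ.+ 13 / 2000) 160 (ℚ.≤ᵇ⇒≤ {0ℚ} {1ℚ + (ℤ.+ 13 / 2000)} _)
    (*-monoˡ {11/10} {1ℚ + fromℕ 170 * (- h)} (ℚ.≤ᵇ⇒≤ {0ℚ} {11/10} _)
      (^-growth (- h) 170 (ℚ.≤ᵇ⇒≤ {0ℚ} {1ℚ - h} _) 1-h≤β)))

-- Scaling both sides of the Chernoff bound by `11/10 ^ j` makes the left factor at least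
-- `2 ^ k ≥ 4 K` and leaves at most `K` on the right, so `y ≤ 1 / 4`.
compare : ∀ {w u y K j} k → j ≡ 160 ℕ.* k → 2ℚ ≤ (w * 11/10) ^ 160 → 0ℚ ≤ u → u * 11/10 ≤ 1ℚ →
          w ^ j * y ≤ K * u ^ j → fromℕ 4 * K ≤ 2ℚ ^ k → 0ℚ < K → y ≤ ℤ.+ 1 / 3
compare {w} {u} {y} {K} {j} k j≡160k 2≤ 0≤u u≤ bound 4K≤ 0<K with ℚ.≤-total y 0ℚ
-- The other case multiplies inequalities by `y` and so relies on its sign.
... | inj₁ y≤0 = ℚ.≤-trans y≤0 (0≤1/ 3)
... | inj₂ 0≤y = ℚ.≤-trans (cancelˡ {q = ℤ.+ 1 / 4} (0<* (fromℕ-pos 4) 0<K) (begin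
    fromℕ 4 * K * y              ≤⟨ *-monoˡ 0≤y 4K≤ ⟩
    2ℚ ^ k * y                   ≤⟨ *-monoˡ 0≤y (^-monoˡ (0≤fromℕ 2) 2≤ k) ⟩
    ((w * 11/10) ^ 160) ^ k * y  ≡⟨ cong (_* y) (trans (^-assocʳ (w * 11/10) 160 k) (cong ((w * 11/10) ^_) (sym j≡160k))) ⟩
    (w * 11/10) ^ j * y          ≡⟨ cong (_* y) (^-distrib-* w 11/10 j) ⟩
    w ^ j * 11/10 ^ j * y        ≡⟨ solve 3 (λ w z y → w :* z :* y := z :* (w :* y)) refl (w ^ j) (11/10 ^ j) y ⟩
    11/10 ^ j * (w ^ j * y)      ≤⟨ *-monoʳ (0≤^ 0≤11/10 j) bound ⟩
    11/10 ^ j * (K * u ^ j)      ≡⟨ solve 3 (λ z K u → z :* (K :* u) := K :* (u :* z)) refl (11/10 ^ j) K (u ^ j) ⟩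
    K * (u ^ j * 11/10 ^ j)      ≡⟨ cong (K *_) (^-distrib-* u 11/10 j) ⟨
    K * (u * 11/10) ^ j          ≤⟨ *-monoʳ (ℚ.<⇒≤ 0<K) (^-monoˡ (0≤* 0≤u 0≤11/10) u≤ j) ⟩
    K * 1ℚ ^ j                   ≡⟨ cong (K *_) (1^n j) ⟩
    K * 1ℚ                       ≡⟨ solve 1 (λ K → K :* con 1ℚ := con (fromℕ 4) :* K :* con (ℤ.+ 1 / 4)) refl K ⟩
    fromℕ 4 * K * (ℤ.+ 1 / 4)    ∎)) (ℚ.≤ᵇ⇒≤ {ℤ.+ 1 / 4} {ℤ.+ 1 / 3} _)
  where
  open ℚ.≤-Reasoning
  0≤11/10 : 0ℚ ≤ 11/10
  0≤11/10 = ℚ.≤ᵇ⇒≤ {0ℚ} {11/10} _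

0<^ : ∀ {x} → 0ℚ < x → ∀ n → 0ℚ < x ^ n
0<^ 0<x zero    = ℚ.positive⁻¹ 1ℚ
0<^ 0<x (suc n) = 0<* 0<x (0<^ 0<x n)

module Choice (p : Parameters) where

  instance
    N≢0 : NonZero (N p)
    N≢0 = ℕ.>-nonZero (0<N p)

  scaling : ∃ λ s → fromℕ 100 ≤ fromℕ (suc s) * ε p × fromℕ (suc s) * ε p ≤ fromℕ 101
  scaling = scale (ε p) {{positive (0<ε p)}} (ℚ.<⇒≤ (ε<1 p))

  -- `2 ^ e` is at least the number `N ^ (r³)` of guesses; the extra 2 in `k` supplies the factor 4
  -- that brings the failure probability down to a quarter.
  r L e k : ℕ
  r = suc (proj₁ scaling)
  L = ⌈log₂ N p ⌉
  e = L ℕ.* (r ℕ.* r) ℕ.* r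
  k = 2 ℕ.+ e

  -- Opaque, since the literal factors would be unfolded to repeated addition.
  opaque
    j : ℕ
    j = 160 ℕ.* k

    j≡160k : j ≡ 160 ℕ.* k
    j≡160k = refl

  opaque
    -- The threshold separates the expected counts: at most `113 j / 2` for the good guess on a
    -- close graph, at least `200 j` for every guess on a far one.
    T : ℕ
    T = 170 ℕ.* j

    T≡170j : T ≡ 170 ℕ.* j
    T≡170j = refl

  m : ℕ
  m = r ℕ.* j

  open Extension {N p} (interval r) (r ℕ.* r)
  open Tester (N p) (interval r) (r ℕ.* r) r m T public

  0≤ε : 0ℚ ≤ ε p
  0≤ε = ℚ.<⇒≤ (0<ε p)

  0<j : 0ℚ < fromℕ j
  0<j = subst (λ j → 0ℚ < fromℕ j) (sym j≡160k) (fromℕ-pos (160 ℕ.* k) {{ℕ.m*n≢0 160 k}})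

  K : ℚ
  K = (fromℕ (N p) ^ (r ℕ.* r)) ^ r

  4K≤2^k : fromℕ 4 * K ≤ 2ℚ ^ k
  4K≤2^k = begin
    fromℕ 4 * K                                    ≤⟨ *-monoʳ (0≤fromℕ 4) (^-monoˡ (0≤^ (0≤fromℕ (N p)) (r ℕ.* r)) (^-monoˡ (0≤fromℕ (N p)) N≤ (r ℕ.* r)) r) ⟩
    fromℕ 4 * ((2ℚ ^ L) ^ (r ℕ.* r)) ^ r           ≡⟨ cong (λ z → fromℕ 4 * z ^ r) (^-assocʳ 2ℚ L (r ℕ.* r)) ⟩
    fromℕ 4 * (2ℚ ^ (L ℕ.* (r ℕ.* r))) ^ r         ≡⟨ cong (fromℕ 4 *_) (^-assocʳ 2ℚ (L ℕ.* (r ℕ.* r)) r) ⟩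
    fromℕ 4 * 2ℚ ^ e                               ≡⟨ solve 1 (λ x → con (fromℕ 4) :* x := con 2ℚ :* (con 2ℚ :* x)) refl (2ℚ ^ e) ⟩
    2ℚ * (2ℚ * 2ℚ ^ e)                             ∎
    where
    open ℚ.≤-Reasoning
    N≤ : fromℕ (N p) ≤ 2ℚ ^ L
    N≤ = subst (fromℕ (N p) ≤_) (fromℕ-^ 2 L) (fromℕ-mono {N p} {2 ℕ.^ L} (n≤2^⌈log₂n⌉ (N p)))

  accepts : ∀ G → Close (ε p * (ℤ.+ 1 / 4)) Clusterable G → ℤ.+ 2 / 3 ≤ probability true G tester
  accepts G close = 2/3≤ (accept-bound {fromℕ r} {E} {cost G c} {ε p} {y} (fromℕ j) 0<j Ty≤mE
    (cost-extend G (interval r) r (interval-spread r G) (interval<r r) c)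
    (proj₂ clustering) (0≤fromℕ r) (proj₂ (proj₂ scaling)))
    where
    y : ℚ
    y = 1ℚ - probability true G tester
    clustering : ∃ λ c → 2ℚ * cost G c ≤ ε p
    clustering = close⇒cost≤ {G = G} close
    c : Fin (N p) → Fin (N p)
    c = proj₁ clustering
    choose : Sample → Coloring
    choose = hybrid G (interval r) r 0 c
    E : ℚ
    E = 𝔼 (mean drawSample) (λ U → cost G (extend G U (choose U)))
    Ty≤mE : fromℕ 170 * fromℕ j * y ≤ fromℕ r * fromℕ j * E
    Ty≤mE = subst₂ (λ t m → t * y ≤ m * E) (trans (cong fromℕ T≡170j) (fromℕ-* 170 j)) (fromℕ-* r j)
      (accept-close (N p) (interval r) (r ℕ.* r) r m T G choose E ℚ.≤-refl)

  -- `β` stays a variable so that its large powers are not evaluated at the literal `1ℚ - h`.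
  rejects-at : ∀ β → 0ℚ ≤ β → β ≤ 1ℚ → 1ℚ - h ≤ β → 1ℚ - β ≡ h →
               ∀ G → Far (ε p) Clusterable G → ℤ.+ 2 / 3 ≤ probability false G tester
  rejects-at β 0≤β β≤1 1-h≤β 1-β≡h G far =
    2/3≤ (compare {β ^ 170} {(1ℚ - h * (2ℚ * ε p)) ^ r} {y} {K} k j≡160k (growth 1-h≤β) (0≤^ (proj₁ dec) r) (proj₂ dec) bound 4K≤2^k
      (0<^ (0<^ (fromℕ-pos (N p)) (r ℕ.* r)) r))
    where
    dec : 0ℚ ≤ 1ℚ - h * (2ℚ * ε p) × (1ℚ - h * (2ℚ * ε p)) ^ r * 11/10 ≤ 1ℚ
    dec = decay r 0≤ε (ℚ.<⇒≤ (ε<1 p)) (proj₁ (proj₂ scaling))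
    y : ℚ
    y = 1ℚ - probability false G tester
    bound : (β ^ 170) ^ j * y ≤ K * ((1ℚ - h * (2ℚ * ε p)) ^ r) ^ j
    bound = begin
      (β ^ 170) ^ j * y                        ≡⟨ cong (_* y) (trans (^-assocʳ β 170 j) (cong (β ^_) (sym T≡170j))) ⟩
      β ^ T * y                                ≤⟨ reject-far (N p) (interval r) (r ℕ.* r) r m T G β (2ℚ * ε p) 0≤β β≤1 (far⇒cost≥ G {ε p} far) (cost≤1 G) ⟩
      K * (1ℚ - (1ℚ - β) * (2ℚ * ε p)) ^ m     ≡⟨ cong (λ h → K * (1ℚ - h * (2ℚ * ε p)) ^ m) 1-β≡h ⟩
      K * (1ℚ - h * (2ℚ * ε p)) ^ m            ≡⟨ cong (K *_) (^-assocʳ (1ℚ - h * (2ℚ * ε p)) r j) ⟨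
      K * ((1ℚ - h * (2ℚ * ε p)) ^ r) ^ j      ∎
      where open ℚ.≤-Reasoning

  rejects : ∀ G → Far (ε p) Clusterable G → ℤ.+ 2 / 3 ≤ probability false G tester
  rejects = rejects-at (1ℚ - h) (ℚ.≤ᵇ⇒≤ {0ℚ} {1ℚ - h} _) (ℚ.≤ᵇ⇒≤ {1ℚ - h} {1ℚ} _) ℚ.≤-refl refl

  queryBound : ℕ
  queryBound = m ℕ.* pairCost

  queryBound≤ : queryBound ℕ.≤ 960 ℕ.* (r ℕ.* (r ℕ.* r ℕ.* r) ℕ.* (r ℕ.* r ℕ.* r)) ℕ.* (1 ℕ.+ L)
  queryBound≤ = begin
    r ℕ.* j ℕ.* pairCost
      ≡⟨ cong (λ j → r ℕ.* j ℕ.* pairCost) j≡160k ⟩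
    r ℕ.* (160 ℕ.* k) ℕ.* pairCost
      ≤⟨ ℕ.*-mono-≤ (ℕ.*-monoʳ-≤ r (ℕ.*-monoʳ-≤ 160 k≤)) pairCost≤ ⟩
    r ℕ.* (160 ℕ.* (2 ℕ.* s ℕ.* (1 ℕ.+ L))) ℕ.* (3 ℕ.* s)
      -- The factors 160, 2 and 3 come from `j`, `k` and `pairCost`; they are passed as variables to
      -- keep the normal forms small.
      ≡⟨ ℕS.solve 6 (λ r s l a b c → r ℕS.:* (a ℕS.:* (b ℕS.:* s ℕS.:* l)) ℕS.:* (c ℕS.:* s) ℕS.:= a ℕS.:* b ℕS.:* c ℕS.:* (r ℕS.:* s ℕS.:* s) ℕS.:* l) refl r s (1 ℕ.+ L) 160 2 3 ⟩
    960 ℕ.* (r ℕ.* s ℕ.* s) ℕ.* (1 ℕ.+ L) ∎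
    where
    open ℕ.≤-Reasoning
    module ℕS = Data.Nat.Solver.+-*-Solver
    s : ℕ
    s = r ℕ.* r ℕ.* r
    1≤s : 1 ℕ.≤ s
    1≤s = ℕ.*-mono-≤ (ℕ.*-mono-≤ {1} {r} {1} {r} (ℕ.s≤s ℕ.z≤n) (ℕ.s≤s ℕ.z≤n)) (ℕ.s≤s ℕ.z≤n)
    k≤ : k ℕ.≤ 2 ℕ.* s ℕ.* (1 ℕ.+ L)
    k≤ = begin
      2 ℕ.+ L ℕ.* (r ℕ.* r) ℕ.* r                 ≤⟨ ℕ.+-mono-≤ (ℕ.*-monoʳ-≤ 2 1≤s) (ℕ.m≤m+n e e) ⟩
      2 ℕ.* s ℕ.+ (e ℕ.+ e)                       ≡⟨ ℕS.solve 2 (λ r l → ℕS.con 2 ℕS.:* (r ℕS.:* r ℕS.:* r) ℕS.:+ (l ℕS.:* (r ℕS.:* r) ℕS.:* r ℕS.:+ l ℕS.:* (r ℕS.:* r) ℕS.:* r) ℕS.:= ℕS.con 2 ℕS.:* (r ℕS.:* r ℕS.:* r) ℕS.:* (ℕS.con 1 ℕS.:+ l)) refl r L ⟩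
      2 ℕ.* s ℕ.* (1 ℕ.+ L)                       ∎
    pairCost≤ : pairCost ℕ.≤ 3 ℕ.* s
    pairCost≤ = begin
      r ℕ.* (r ℕ.* r ℕ.* 1) ℕ.+ r ℕ.* (r ℕ.* r ℕ.* 1) ℕ.+ 1   ≤⟨ ℕ.+-monoʳ-≤ (r ℕ.* (r ℕ.* r ℕ.* 1) ℕ.+ r ℕ.* (r ℕ.* r ℕ.* 1)) {1} {s} 1≤s ⟩
      r ℕ.* (r ℕ.* r ℕ.* 1) ℕ.+ r ℕ.* (r ℕ.* r ℕ.* 1) ℕ.+ s   ≡⟨ ℕS.solve 1 (λ r → r ℕS.:* (r ℕS.:* r ℕS.:* ℕS.con 1) ℕS.:+ r ℕS.:* (r ℕS.:* r ℕS.:* ℕS.con 1) ℕS.:+ r ℕS.:* r ℕS.:* r ℕS.:= ℕS.con 3 ℕS.:* (r ℕS.:* r ℕS.:* r)) refl r ⟩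
      3 ℕ.* s                                                 ∎

  1/ε≥0 : 0ℚ ≤ 1/ε p
  1/ε≥0 = ℚ.<⇒≤ (ℚ.positive⁻¹ (1/ε p) {{ℚ.1/pos⇒pos (ε p) {{positive (0<ε p)}}}})

  r≤101/ε : fromℕ r ≤ fromℕ 101 * 1/ε p
  r≤101/ε = begin
    fromℕ r                       ≡⟨ ℚ.*-identityʳ (fromℕ r) ⟨
    fromℕ r * 1ℚ                  ≡⟨ cong (fromℕ r *_) (ℚ.*-inverseʳ (ε p) {{>-nonZero (0<ε p)}}) ⟨
    fromℕ r * (ε p * 1/ε p)       ≡⟨ ℚ.*-assoc (fromℕ r) (ε p) (1/ε p) ⟨
    fromℕ r * ε p * 1/ε p         ≤⟨ *-monoˡ 1/ε≥0 (proj₂ (proj₂ scaling)) ⟩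
    fromℕ 101 * 1/ε p             ∎
    where open ℚ.≤-Reasoning

  -- The seven factors `r` are one from `m`, three from the logarithm of the number of guesses and
  -- three from the queries per pair. `l` stands for the logarithm of `1/ε ^ 7`; the first power of
  -- the logarithmic factor is enough.
  queryBound∈Õ : ∀ l → fromℕ queryBound ≤ fromℕ (960 ℕ.* 101 ℕ.^ 7) * 1/ε p ^ 7 * fromℕ ((1 ℕ.+ l ℕ.+ L) ℕ.^ 1)
  queryBound∈Õ l = begin
    fromℕ queryBound
      ≤⟨ fromℕ-mono {queryBound} {960 ℕ.* r⁷ ℕ.* (1 ℕ.+ L)} queryBound≤ ⟩
    fromℕ (960 ℕ.* r⁷ ℕ.* (1 ℕ.+ L))
      ≡⟨ trans (fromℕ-* (960 ℕ.* r⁷) (1 ℕ.+ L)) (cong (_* fromℕ (1 ℕ.+ L)) (trans (fromℕ-* 960 r⁷) (cong (fromℕ 960 *_) r⁷≡))) ⟩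
    fromℕ 960 * fromℕ r ^ 7 * fromℕ (1 ℕ.+ L)
      ≤⟨ *-monoˡ (0≤fromℕ (1 ℕ.+ L)) (*-monoʳ (0≤fromℕ 960) (^-monoˡ (0≤fromℕ r) r≤101/ε 7)) ⟩
    fromℕ 960 * (fromℕ 101 * 1/ε p) ^ 7 * fromℕ (1 ℕ.+ L)
      ≡⟨ cong (_* fromℕ (1 ℕ.+ L)) (trans (cong (fromℕ 960 *_) (^-distrib-* (fromℕ 101) (1/ε p) 7)) (sym (ℚ.*-assoc (fromℕ 960) (fromℕ 101 ^ 7) (1/ε p ^ 7)))) ⟩
    fromℕ 960 * fromℕ 101 ^ 7 * 1/ε p ^ 7 * fromℕ (1 ℕ.+ L)
      ≤⟨ *-monoʳ (0≤* (ℚ.≤ᵇ⇒≤ {0ℚ} {fromℕ 960 * fromℕ 101 ^ 7} _) (0≤^ 1/ε≥0 7)) (fromℕ-mono {1 ℕ.+ L} {(1 ℕ.+ l ℕ.+ L) ℕ.^ 1} logs≤) ⟩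
    fromℕ 960 * fromℕ 101 ^ 7 * 1/ε p ^ 7 * fromℕ ((1 ℕ.+ l ℕ.+ L) ℕ.^ 1)
      ≡⟨⟩
    fromℕ (960 ℕ.* 101 ℕ.^ 7) * 1/ε p ^ 7 * fromℕ ((1 ℕ.+ l ℕ.+ L) ℕ.^ 1) ∎
    where
    open ℚ.≤-Reasoning
    r⁷ : ℕ
    r⁷ = r ℕ.* (r ℕ.* r ℕ.* r) ℕ.* (r ℕ.* r ℕ.* r)
    r⁷≡ : fromℕ r⁷ ≡ fromℕ r ^ 7
    r⁷≡ = trans (cong fromℕ (ℕS.solve 1 (λ r → r ℕS.:* (r ℕS.:* r ℕS.:* r) ℕS.:* (r ℕS.:* r ℕS.:* r) ℕS.:= r ℕS.:* (r ℕS.:* (r ℕS.:* (r ℕS.:* (r ℕS.:* (r ℕS.:* (r ℕS.:* ℕS.con 1))))))) refl r)) (fromℕ-^ r 7)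
      where module ℕS = Data.Nat.Solver.+-*-Solver
    logs≤ : 1 ℕ.+ L ℕ.≤ (1 ℕ.+ l ℕ.+ L) ℕ.^ 1
    logs≤ = ℕ.≤-trans (ℕ.+-monoˡ-≤ L (ℕ.m≤m+n 1 l)) (ℕ.≤-reflexive (sym (ℕ.*-identityʳ (1 ℕ.+ l ℕ.+ L))))

theorem4 : Σ ((p : Parameters) → Algorithm (N p)) λ tester →
    (∀ p → IsTolerantTester Clusterable (ε p * (ℤ.+ 1 / 4)) (ε p) (tester p)) ×
    Σ (Parameters → ℕ) λ q →
    (∀ p (G : SignedGraph (N p)) → queries G (tester p) ℕ.≤ q p) ×
    q ∈Õ (λ p → 1/ε p ^ 7)
theorem4 = Choice.tester ,
  (λ p → record { accepts = Choice.accepts p ; rejects = Choice.rejects p }) ,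
  Choice.queryBound ,
  (λ p G → Choice.queries-tester p G) ,
  960 ℕ.* 101 ℕ.^ 7 , 1 , λ p → Choice.queryBound∈Õ p ⌈log₂ ℤ.∣ ceiling (1/ε p ^ 7) ∣ ⌉
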